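{- Let $M_G$ be a connected mixed graph with rank $2$. Then $M_G$ is switching equivalent to every connected mixed graph that is cospectral with $M_G$.
   Context: A mixed graph $M_G$ is obtained from a finite simple graph $G$ by orienting the edges of some subset of $E(G)$; it is connected if $G$ is. With $\omega=\frac{1+\mathbf{i}\sqrt3}{2}$, $N(M_G)$ has $(u,v)$-entry $\omega$ if $\overrightarrow{uv}$ is an arc, $\bar\omega$ if $\overrightarrow{vu}$ is an arc, $1$ for an undirected edge, $0$ otherwise; rank and spectrum of $M_G$ are those of $N(M_G)$, and cospectral means equal spectra. Let $\mathbb{T}_6=\{\pm1,\pm\omega,\pm\bar\omega\}$. Given a partition $V(M_G)=\bigcup_{j\in\mathbb{T}_6}V_j$, an edge $xy$ has type $(j,k)$ if $x\in V_j,y\in V_k$; the partition is admissible if each undirected edge has type $(j,j)$ or $(j,\omega j)$ and each arc has type $(j,j)$, $(j,\bar\omega j)$ or $(j,-\omega j)$ for some $j$. A three-way switching w.r.t. an admissible partition turns undirected edges of type $(j,\omega j)$ into arcs from $V_j$ to $V_{\omega j}$, arcs of type $(j,\bar\omega j)$ into undirected edges, and reverses arcs of type $(j,-\omega j)$. The converse reverses all arcs. Two mixed graphs are switching equivalent if one is obtained from the other (up to isomorphism) by a sequence of three-way switchings and taking converses. -}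

module Defs where

open import Data.Nat as ℕ using (ℕ; zero; suc; _∸_)
open import Data.Nat.DivMod using (_mod_)
open import Data.Integer as ℤ using (ℤ; +_; -[1+_])
open import Data.Fin as Fin using (Fin; zero; suc; toℕ; punchIn)
open import Data.Fin.Properties using () renaming (_≟_ to _≟ᶠ_)
open import Data.Bool using (Bool; true; false; if_then_else_)
open import Data.Product using (Σ; _×_; _,_; ∃)
open import Data.Sum using (_⊎_)
open import Relation.Nullary using (¬_; yes; no)
open import Relation.Nullary.Decidable using (⌊_⌋)
open import Relation.Binary.PropositionalEquality using (_≡_)
open import Relation.Binary.Construct.Closure.ReflexiveTransitive using (Star)
open import Function.Bundles using (_↔_; Inverse)

-- Eisenstein integers ℤ[ω], ω = (1 + i√3)/2, ω² = ω - 1.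
-- ⟨ a , b ⟩ represents a + b ω.  All entries of N(M_G) lie here,
-- and ℤ[ω] ⊂ ℂ, so determinants computed here are the complex ones.

record ℤω : Set where
  constructor ⟨_,_⟩
  field
    re : ℤ
    im : ℤ
open ℤω public

0ω 1ω ωω ω̄ : ℤω
0ω = ⟨ + 0 , + 0 ⟩
1ω = ⟨ + 1 , + 0 ⟩
ωω = ⟨ + 0 , + 1 ⟩
ω̄ = ⟨ + 1 , -[1+ 0 ] ⟩

_+ω_ : ℤω → ℤω → ℤω
⟨ a , b ⟩ +ω ⟨ c , d ⟩ = ⟨ a ℤ.+ c , b ℤ.+ d ⟩

-ω_ : ℤω → ℤω
-ω ⟨ a , b ⟩ = ⟨ ℤ.- a , ℤ.- b ⟩

-- (a + bω)(c + dω) = ac + (ad + bc)ω + bd ω² = (ac - bd) + (ad + bc + bd)ω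
_*ω_ : ℤω → ℤω → ℤω
⟨ a , b ⟩ *ω ⟨ c , d ⟩ =
  ⟨ a ℤ.* c ℤ.- b ℤ.* d , a ℤ.* d ℤ.+ b ℤ.* c ℤ.+ b ℤ.* d ⟩

module Det {A : Set} (0# 1# : A) (_⊕_ _⊗_ : A → A → A) (⊖_ : A → A) where

  sumF : ∀ {n} → (Fin n → A) → A
  sumF {zero} f = 0#
  sumF {suc n} f = f zero ⊕ sumF (λ i → f (suc i))

  sign : ℕ → A → A
  sign zero a = a
  sign (suc zero) a = ⊖ a
  sign (suc (suc k)) a = sign k a

  det : ∀ {n} → (Fin n → Fin n → A) → A
  det {zero} M = 1#
  det {suc n} M =
    sumF (λ j → sign (toℕ j) (M zero j ⊗ det (λ i k → M (suc i) (punchIn j k))))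

detω : ∀ {n} → (Fin n → Fin n → ℤω) → ℤω
detω = Det.det 0ω 1ω _+ω_ _*ω_ -ω_

Poly : Set
Poly = ℕ → ℤω

0p 1p X : Poly
0p k = 0ω
1p zero = 1ω
1p (suc k) = 0ω
X (suc zero) = 1ω
X _ = 0ω

constP : ℤω → Poly
constP a zero = a
constP a (suc k) = 0ω

_+p_ : Poly → Poly → Poly
(p +p q) k = p k +ω q k

-p_ : Poly → Poly
(-p p) k = -ω (p k)

_*p_ : Poly → Poly → Poly
(p *p q) k = Det.sumF 0ω 1ω _+ω_ _*ω_ -ω_ {suc k} (λ i → p (toℕ i) *ω q (k ∸ toℕ i))

detP : ∀ {n} → (Fin n → Fin n → Poly) → Poly
detP = Det.det 0p 1p _+p_ _*p_ -p_

-- Mixed graphs on vertex set Fin n.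
-- For an ordered pair (i , j):  none = no edge, und = undirected edge,
-- arc = arc i → j,  rev = arc j → i.

data Edge : Set where
  none und arc rev : Edge

flipE : Edge → Edge
flipE none = none
flipE und = und
flipE arc = rev
flipE rev = arc

record MixedGraph (n : ℕ) : Set where
  field
    adj   : Fin n → Fin n → Edge
    loopless : ∀ i → adj i i ≡ none
    sym   : ∀ i j → adj j i ≡ flipE (adj i j)
open MixedGraph public

Adjacent : ∀ {n} → MixedGraph n → Fin n → Fin n → Set
Adjacent M i j = ¬ (adj M i j ≡ none)

Connected : ∀ {n} → MixedGraph n → Set
Connected {n} M = ∀ (i j : Fin n) → Star (Adjacent M) i j

entryN : Edge → ℤω
entryN none = 0ω
entryN und = 1ω
entryN arc = ωω
entryN rev = ω̄

N : ∀ {n} → MixedGraph n → Fin n → Fin n → ℤω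
N M i j = entryN (adj M i j)

-- Rank (determinantal rank: largest order of a nonzero minor).
-- ℤ[ω] is a subring of ℂ, so this is the rank over ℂ.

minor : ∀ {n r} → (Fin n → Fin n → ℤω) → (Fin r → Fin n) → (Fin r → Fin n) → ℤω
minor A f g = detω (λ a b → A (f a) (g b))

HasRank : ∀ {n} → (Fin n → Fin n → ℤω) → ℕ → Set
HasRank {n} A r =
  (Σ (Fin r → Fin n) λ f → Σ (Fin r → Fin n) λ g → ¬ (minor A f g ≡ 0ω))
  × (∀ (f g : Fin (suc r) → Fin n) → minor A f g ≡ 0ω)

rankIs : ∀ {n} → MixedGraph n → ℕ → Set
rankIs M r = HasRank (N M) r

-- Spectrum: the spectrum of the Hermitian matrix N is the multiset of
-- roots of its characteristic polynomial det(xI - N); we compare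
-- characteristic polynomials coefficientwise.

charPoly : ∀ {n} → MixedGraph n → Poly
charPoly M = detP (λ i j → (if ⌊ i ≟ᶠ j ⌋ then X else 0p) +p (-p constP (N M i j)))

Cospectral : ∀ {n m} → MixedGraph n → MixedGraph m → Set
Cospectral M M' = ∀ k → charPoly M k ≡ charPoly M' k

-- T₆ = {±1, ±ω, ±ω̄} = {ω^k : k ∈ ℤ/6}; we encode ω^k by k : Fin 6.
-- Multiplication by ω is +1, by ω̄ is +5, by -ω (= ω⁴) is +4.

T6 : Set
T6 = Fin 6

_⊕6_ : T6 → ℕ → T6
j ⊕6 k = (toℕ j ℕ.+ k) mod 6

-- admissible partition p : V → T₆ (vertex x lies in V_{p x})
Admissible : ∀ {n} → MixedGraph n → (Fin n → T6) → Set
Admissible M p =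
  (∀ x y → adj M x y ≡ und →
     (p y ≡ p x) ⊎ (p y ≡ p x ⊕6 1) ⊎ (p x ≡ p y ⊕6 1))
  × (∀ x y → adj M x y ≡ arc →
     (p y ≡ p x) ⊎ (p y ≡ p x ⊕6 5) ⊎ (p y ≡ p x ⊕6 4))

-- new entry of the ordered pair (x , y), x ∈ V_j, y ∈ V_k
switchEntry : T6 → T6 → Edge → Edge
switchEntry j k none = none
switchEntry j k und with k ≟ᶠ (j ⊕6 1) | j ≟ᶠ (k ⊕6 1)
... | yes _ | _ = arc
... | no _ | yes _ = rev  -- type (ωk, k) seen from the other end
... | no _ | no _ = und
switchEntry j k arc with k ≟ᶠ (j ⊕6 5) | k ≟ᶠ (j ⊕6 4)
... | yes _ | _ = und
... | no _ | yes _ = rev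
... | no _ | no _ = arc
switchEntry j k rev with j ≟ᶠ (k ⊕6 5) | j ≟ᶠ (k ⊕6 4)
... | yes _ | _ = und
... | no _ | yes _ = arc
... | no _ | no _ = rev

ThreeWaySwitching : ∀ {n} → MixedGraph n → MixedGraph n → Set
ThreeWaySwitching {n} M M' =
  Σ (Fin n → T6) λ p → Admissible M p
    × (∀ x y → adj M' x y ≡ switchEntry (p x) (p y) (adj M x y))

Converse : ∀ {n} → MixedGraph n → MixedGraph n → Set
Converse M M' = ∀ x y → adj M' x y ≡ flipE (adj M x y)

Isomorphic : ∀ {n m} → MixedGraph n → MixedGraph m → Set
Isomorphic {n} {m} M M' =
  Σ (Fin n ↔ Fin m) λ σ → ∀ x y → adj M' (Inverse.to σ x) (Inverse.to σ y) ≡ adj M x y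

MG : Set
MG = Σ ℕ MixedGraph

data Step : MG → MG → Set where
  switch : ∀ {n} {M M' : MixedGraph n} → ThreeWaySwitching M M' → Step (n , M) (n , M')
  conv   : ∀ {n} {M M' : MixedGraph n} → Converse M M' → Step (n , M) (n , M')
  iso    : ∀ {n m} {M : MixedGraph n} {M' : MixedGraph m} → Isomorphic M M' → Step (n , M) (m , M')

SwitchingEquivalent : ∀ {n m} → MixedGraph n → MixedGraph m → Set
SwitchingEquivalent {n} {m} M M' = Star Step (n , M) (m , M') ⊎ Star Step (m , M') (n , M)

{-# OPTIONS --safe #-}
module Submission where

-- Let A = N(M).  All 3 × 3 minors of A vanish exactly when the sum of their squared absolute values
-- does; for a Hermitian matrix that sum is 6 (t₁³ − 3 t₁ t₂ + 2 t₃) with tₖ = tr A²ᵏ.  Newton's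
-- identities, read off (X I − A) adj (X I − A) = det (X I − A) I and X d/dX det (X I − A) =
-- tr (X adj (X I − A)), show that the characteristic polynomial determines the order and all power
-- sums tr Aᵏ, so every graph cospectral with a graph of rank 2 has vanishing 3 × 3 minors as well.
--
-- If these minors vanish and uv is an edge, then A_xy = A_uv A_xu A_vy + A_vu A_xv A_uy.  No element
-- of T₆ is purely imaginary, so the minor on {u, v, x} excludes triangles, and connectedness makes
-- every vertex adjacent to exactly one of u and v.  Hence the graph is complete bipartite and
-- A_xy = ω ^ (φ y − φ x) on its edges.  Finally n and tr A² = 2ab determine the sizes {a, b} of the
-- parts; after matching the parts by a bijection, the partition given by the difference of the two
-- phase functions φ switches one graph into the other.

-- Rank is given by minors and the spectrum by coefficients, so the bridge between them is built
-- from polynomial identities, without eigenvalues. In terms of eigenvalues, the sum of the squared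
-- absolute values of the minors runs over ordered triples of rows and of columns, hence equals 36
-- e₃, where e₃ is the third elementary symmetric function of the squared eigenvalues (Cauchy-Binet
-- for A A* = A²), and 6 e₃ is a polynomial in t₁, t₂, t₃. Only a sum of squares lets the vanishing
-- of this single number return to the individual minors. Newton's identities serve in the direction
-- from coefficients to power sums, which needs no division, so everything stays inside ℤ[ω].
--
-- A three-way switching is conjugation of N by a diagonal matrix of powers of ω. Two nonzero
-- entries differ by a factor ω^k with |k| ≤ 2, and each such change is one of the admissible types
-- when read from a suitable end of the edge. This is why any two phase functions on the same
-- complete bipartite graph are joined by a single switching.

open import Algebra.Bundles using (CommutativeRing)
open import Data.Bool using (Bool; true; false; not; if_then_else_)
open import Data.Bool.Properties using () renaming (_≟_ to _≟ᵇ_)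
open import Data.Empty using (⊥; ⊥-elim)
open import Data.Fin using (Fin; zero; suc; toℕ; punchIn; _<_)
open import Data.Fin.Permutation as Perm using (Permutation; _⟨$⟩ʳ_)
open import Data.Fin.Properties using (all?; <-cmp) renaming (_≟_ to _≟ᶠ_)
open import Data.Integer as ℤ using (ℤ; +_; -[1+_])
import Data.Integer.Properties as ℤₚ
open import Data.Integer.Tactic.RingSolver using (solve-∀)
open import Data.Nat as ℕ using (ℕ; zero; suc; z≤n; s≤s; _∸_)
import Data.Nat.Properties as ℕₚ
open import Data.Product using (Σ; ∃; _×_; _,_; proj₁; proj₂)
open import Data.Sum as Sum using (_⊎_; inj₁; inj₂; [_,_]′)
open import Function using (_∘_)
open import Level using (0ℓ)
open import Relation.Binary.Construct.Closure.ReflexiveTransitive using (Star; ε; _◅_)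
open import Relation.Binary.Definitions using (tri<; tri≈; tri>)
open import Relation.Binary.PropositionalEquality as ≡ using (_≡_; _≢_)
open import Relation.Nullary using (¬_; Dec; yes; no)
open import Relation.Nullary.Decidable using (⌊_⌋; map′; toWitness; _→-dec_; _×-dec_; _⊎-dec_; ¬?)
open import Algebra.Properties.CommutativeMonoid.Sum ℕₚ.+-0-commutativeMonoid using () renaming (sum to sumℕ; sum-remove to sumℕ-remove)
open import Defs hiding (sym)


-- Determinants over a commutative ring: alternation, row linearity, adjugate, Jacobi's formula.

-- Deleting column j and then column k leaves out the columns j and punchIn j k; Swap j k j′ k′ says
-- that (j′ , k′) leaves out the same two columns in the opposite order.
data Swap : ∀ {n} → Fin (suc n) → Fin n → Fin (suc n) → Fin n → Set where
  left  : ∀ {n} {k : Fin (suc n)} → Swap zero k (suc k) zero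
  right : ∀ {n} {k : Fin (suc n)} → Swap (suc k) zero zero k
  both  : ∀ {n} {j j′ : Fin (suc n)} {k k′ : Fin n} → Swap j k j′ k′ → Swap (suc j) (suc k) (suc j′) (suc k′)

swap-sym : ∀ {n} {j j′ : Fin (suc n)} {k k′} → Swap j k j′ k′ → Swap j′ k′ j k
swap-sym left     = right
swap-sym right    = left
swap-sym (both s) = both (swap-sym s)

swap-punchIn : ∀ {n} {j j′ : Fin (suc n)} {k k′} → Swap j k j′ k′ → punchIn j k ≡ j′
swap-punchIn left     = ≡.refl
swap-punchIn right    = ≡.refl
swap-punchIn (both s) = ≡.cong suc (swap-punchIn s)

swap-columns : ∀ {n} {j j′ : Fin (suc (suc n))} {k k′} → Swap j k j′ k′ →
  ∀ c → punchIn j (punchIn k c) ≡ punchIn j′ (punchIn k′ c)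
swap-columns left     c       = ≡.refl
swap-columns right    c       = ≡.refl
swap-columns (both s) zero    = ≡.refl
swap-columns (both s) (suc c) = ≡.cong suc (swap-columns s c)

setRow : ∀ {A : Set} {n m} → (Fin n → Fin m → A) → Fin n → (Fin m → A) → Fin n → Fin m → A
setRow M zero    r zero    = r
setRow M zero    r (suc k) = M (suc k)
setRow M (suc i) r zero    = M zero
setRow M (suc i) r (suc k) = setRow (M ∘ suc) i r k

setRow-same : ∀ {A : Set} {n m} (M : Fin n → Fin m → A) i r → setRow M i r i ≡ r
setRow-same M zero    r = ≡.refl
setRow-same M (suc i) r = setRow-same (M ∘ suc) i r

setRow-other : ∀ {A : Set} {n m} (M : Fin n → Fin m → A) i r k → i ≢ k → setRow M i r k ≡ M k
setRow-other M zero    r zero    i≢k = ⊥-elim (i≢k ≡.refl)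
setRow-other M zero    r (suc k) i≢k = ≡.refl
setRow-other M (suc i) r zero    i≢k = ≡.refl
setRow-other M (suc i) r (suc k) i≢k = setRow-other (M ∘ suc) i r k (i≢k ∘ ≡.cong suc)

setRow-self : ∀ {A : Set} {n m} (M : Fin n → Fin m → A) i k → setRow M i (M i) k ≡ M k
setRow-self M zero    zero    = ≡.refl
setRow-self M zero    (suc k) = ≡.refl
setRow-self M (suc i) zero    = ≡.refl
setRow-self M (suc i) (suc k) = setRow-self (M ∘ suc) i k

setRow-columns : ∀ {A : Set} {n m l} (M : Fin n → Fin m → A) i r (h : Fin l → Fin m) a b →
  setRow M i r a (h b) ≡ setRow (λ a b → M a (h b)) i (r ∘ h) a b
setRow-columns M zero    r h zero    b = ≡.refl
setRow-columns M zero    r h (suc a) b = ≡.refl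
setRow-columns M (suc i) r h zero    b = ≡.refl
setRow-columns M (suc i) r h (suc a) b = setRow-columns (M ∘ suc) i r h a b

-- The sum is abstract so that its summand can be inferred from an equation between sums.
module Summation (R : CommutativeRing 0ℓ 0ℓ) where

  open CommutativeRing R hiding (zero)
  open import Algebra.Properties.Semiring.Sum semiring

  abstract

    ∑ : ∀ {n} → (Fin n → Carrier) → Carrier
    ∑ = sum

    ∑-empty : (f : Fin 0 → Carrier) → ∑ f ≈ 0#
    ∑-empty f = refl

    ∑-suc : ∀ {n} (f : Fin (suc n) → Carrier) → ∑ f ≈ f zero + ∑ (f ∘ suc)
    ∑-suc f = refl

    ∑-cong : ∀ {n} {f g : Fin n → Carrier} → (∀ i → f i ≈ g i) → ∑ f ≈ ∑ g
    ∑-cong = sum-cong-≋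

    ∑-zero : ∀ {n} {f : Fin n → Carrier} → (∀ i → f i ≈ 0#) → ∑ f ≈ 0#
    ∑-zero {n} f≈0 = trans (sum-cong-≋ f≈0) (sum-replicate-zero n)

    ∑-+ : ∀ {n} (f g : Fin n → Carrier) → ∑ (λ i → f i + g i) ≈ ∑ f + ∑ g
    ∑-+ = ∑-distrib-+

    ∑-swap : ∀ {m n} (f : Fin m → Fin n → Carrier) → ∑ (λ i → ∑ (f i)) ≈ ∑ (λ j → ∑ (λ i → f i j))
    ∑-swap = ∑-comm

    *-∑ : ∀ {n} a (f : Fin n → Carrier) → a * ∑ f ≈ ∑ (λ i → a * f i)
    *-∑ = *-distribˡ-sum

    ∑-* : ∀ {n} a (f : Fin n → Carrier) → ∑ f * a ≈ ∑ (λ i → f i * a)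
    ∑-* = *-distribʳ-sum

module Determinant (R : CommutativeRing 0ℓ 0ℓ) where

  open CommutativeRing R hiding (zero)
  open Det 0# 1# _+_ _*_ (-_) public
  open import Algebra.Properties.Ring ring
  open Summation R public
  open import Relation.Binary.Reasoning.Setoid setoid
  open import Algebra.Properties.CommutativeSemigroup *-commutativeSemigroup using (x∙yz≈y∙xz)

  Matrix : ℕ → Set
  Matrix n = Fin n → Fin n → Carrier

  sumF≈∑ : ∀ {n} (f : Fin n → Carrier) → sumF f ≈ ∑ f
  sumF≈∑ {zero}  f = sym (∑-empty f)
  sumF≈∑ {suc n} f = trans (+-congˡ (sumF≈∑ (f ∘ suc))) (sym (∑-suc f))

  ∑-neg : ∀ {n} (f : Fin n → Carrier) → ∑ (λ i → - f i) ≈ - ∑ f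
  ∑-neg f = trans (∑-cong (λ i → sym (-1*x≈-x (f i)))) (trans (sym (*-∑ _ _)) (-1*x≈-x _))

  sgn : ℕ → Carrier
  sgn k = sign k 1#

  sign≈sgn* : ∀ k a → sign k a ≈ sgn k * a
  sign≈sgn* zero          a = sym (*-identityˡ a)
  sign≈sgn* (suc zero)    a = trans (-‿cong (sym (*-identityˡ a))) (-‿distribˡ-* 1# a)
  sign≈sgn* (suc (suc k)) a = sign≈sgn* k a

  sgn-suc : ∀ k → sgn (suc k) ≈ - sgn k
  sgn-suc zero          = refl
  sgn-suc (suc zero)    = sym (-‿involutive 1#)
  sgn-suc (suc (suc k)) = sgn-suc k

  minor₀ : ∀ {n} → Matrix (suc n) → Fin (suc n) → Matrix n
  minor₀ M j i k = M (suc i) (punchIn j k)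

  det-expand : ∀ {n} (M : Matrix (suc n)) →
    det M ≈ ∑ (λ j → sgn (toℕ j) * (M zero j * det (minor₀ M j)))
  det-expand M = trans (sumF≈∑ (λ j → sign (toℕ j) (M zero j * det (minor₀ M j)))) (∑-cong (λ j → sign≈sgn* (toℕ j) _))

  det-cong : ∀ {n} {M M′ : Matrix n} → (∀ i j → M i j ≈ M′ i j) → det M ≈ det M′
  det-cong {zero}  eq = refl
  det-cong {suc n} {M} {M′} eq = begin
    det M                                                   ≈⟨ det-expand M ⟩
    ∑ (λ j → sgn (toℕ j) * (M zero j * det (minor₀ M j)))   ≈⟨ ∑-cong (λ j → *-congˡ (*-cong (eq zero j) (det-cong (λ a b → eq (suc a) (punchIn j b))))) ⟩
    ∑ (λ j → sgn (toℕ j) * (M′ zero j * det (minor₀ M′ j))) ≈⟨ sym (det-expand M′) ⟩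
    det M′                                                  ∎

  det-cong-≡ : ∀ {n} {M M′ : Matrix n} → (∀ i j → M i j ≡ M′ i j) → det M ≈ det M′
  det-cong-≡ eq = det-cong (λ i j → reflexive (eq i j))

  -- The signed sum in a Laplace expansion along two rows: `j` is the column used in row 0, and `k`
  -- is the position of the column used in row 1 once `j` is deleted.
  twisted : ∀ {n} → (Fin (suc n) → Fin n → Carrier) → Carrier
  twisted H = ∑ (λ j → ∑ (λ k → sgn (toℕ j) * (sgn (toℕ k) * H j k)))

  sgn-suc-suc : ∀ j k a → sgn (suc j) * (sgn (suc k) * a) ≈ sgn j * (sgn k * a)
  sgn-suc-suc j k a = begin
    sgn (suc j) * (sgn (suc k) * a) ≈⟨ *-cong (sgn-suc j) (*-congʳ (sgn-suc k)) ⟩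
    - sgn j * (- sgn k * a)         ≈⟨ *-congˡ (sym (-‿distribˡ-* (sgn k) a)) ⟩
    - sgn j * - (sgn k * a)         ≈⟨ sym (-‿distribˡ-* (sgn j) _) ⟩
    - (sgn j * - (sgn k * a))       ≈⟨ -‿cong (sym (-‿distribʳ-* (sgn j) _)) ⟩
    - - (sgn j * (sgn k * a))       ≈⟨ -‿involutive _ ⟩
    sgn j * (sgn k * a)             ∎

  -- The two orders of deleting a pair of columns carry opposite signs, since deleting the smaller
  -- column first lowers the position of the larger by one. Terms with `j` = 0 cancel against terms
  -- with `k` = 0; raising both indices keeps the sign, so what remains is the same sum one size
  -- smaller.
  twisted-symmetric : ∀ {n} (H : Fin (suc n) → Fin n → Carrier) →
    (∀ {j j′ k k′} → Swap j k j′ k′ → H j k ≈ H j′ k′) → twisted H ≈ 0#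
  twisted-symmetric {zero}  H symm = ∑-zero (λ j → ∑-empty _)
  twisted-symmetric {suc n} H symm = begin
    twisted H                             ≈⟨ trans (∑-suc _) (+-congˡ (∑-cong (λ j → ∑-suc _))) ⟩
    ∑ a + ∑ (λ j → b j + ∑ (c j))   ≈⟨ +-congˡ (∑-+ b (λ j → ∑ (c j))) ⟩
    ∑ a + (∑ b + ∑ (λ j → ∑ (c j))) ≈⟨ sym (+-assoc _ _ _) ⟩
    ∑ a + ∑ b + ∑ (λ j → ∑ (c j)) ≈⟨ +-cong (trans (sym (∑-+ a b)) (∑-zero cancel))
                                                    (trans (∑-cong (λ j → ∑-cong (λ k → sgn-suc-suc (toℕ j) (toℕ k) _)))
                                                           (twisted-symmetric (λ j k → H (suc j) (suc k)) (λ s → symm (both s)))) ⟩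
    0# + 0#                               ≈⟨ +-identityˡ 0# ⟩
    0#                                    ∎
    where
    a b : Fin (suc n) → Carrier
    a k = sgn 0 * (sgn (toℕ k) * H zero k)
    b j = sgn (suc (toℕ j)) * (sgn 0 * H (suc j) zero)
    c : Fin (suc n) → Fin n → Carrier
    c j k = sgn (suc (toℕ j)) * (sgn (suc (toℕ k)) * H (suc j) (suc k))
    cancel : ∀ k → a k + b k ≈ 0#
    cancel k = begin
      1# * (sgn (toℕ k) * H zero k) + sgn (suc (toℕ k)) * (1# * H (suc k) zero)
        ≈⟨ +-cong (*-identityˡ _) (*-cong (sgn-suc (toℕ k)) (trans (*-identityˡ _) (symm right))) ⟩
      sgn (toℕ k) * H zero k + - sgn (toℕ k) * H zero k
        ≈⟨ +-congˡ (sym (-‿distribˡ-* _ _)) ⟩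
      sgn (toℕ k) * H zero k + - (sgn (toℕ k) * H zero k)
        ≈⟨ -‿inverseʳ _ ⟩
      0# ∎

  twisted-+ : ∀ {n} (H H′ : Fin (suc n) → Fin n → Carrier) →
    twisted (λ j k → H j k + H′ j k) ≈ twisted H + twisted H′
  twisted-+ H H′ = begin
    twisted (λ j k → H j k + H′ j k)
      ≈⟨ ∑-cong (λ j → trans (∑-cong (λ k → trans (*-congˡ (distribˡ _ _ _)) (distribˡ _ _ _))) (∑-+ _ _)) ⟩
    ∑ (λ j → ∑ (λ k → sgn (toℕ j) * (sgn (toℕ k) * H j k)) + ∑ (λ k → sgn (toℕ j) * (sgn (toℕ k) * H′ j k)))
      ≈⟨ ∑-+ _ _ ⟩
    twisted H + twisted H′ ∎

  twisted-swap : ∀ {n} (H H′ : Fin (suc n) → Fin n → Carrier) →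
    (∀ {j j′ k k′} → Swap j k j′ k′ → H j k ≈ H′ j′ k′) → twisted H + twisted H′ ≈ 0#
  twisted-swap H H′ eq = trans (sym (twisted-+ H H′))
    (twisted-symmetric _ (λ s → trans (+-cong (eq s) (sym (eq (swap-sym s)))) (+-comm _ _)))

  minor₀₁ : ∀ {n} → Matrix (suc (suc n)) → Fin (suc (suc n)) → Fin (suc n) → Matrix n
  minor₀₁ M j k = minor₀ (minor₀ M j) k

  expand₂ : ∀ {n} → Matrix (suc (suc n)) → Fin (suc (suc n)) → Fin (suc n) → Carrier
  expand₂ M j k = M zero j * M (suc zero) (punchIn j k) * det (minor₀₁ M j k)

  det-expand₂ : ∀ {n} (M : Matrix (suc (suc n))) → det M ≈ twisted (expand₂ M)
  det-expand₂ M = trans (det-expand M) (∑-cong λ j → begin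
    sgn (toℕ j) * (M zero j * det (minor₀ M j))
      ≈⟨ *-congˡ (*-congˡ (det-expand (minor₀ M j))) ⟩
    sgn (toℕ j) * (M zero j * ∑ (λ k → sgn (toℕ k) * (M (suc zero) (punchIn j k) * det (minor₀₁ M j k))))
      ≈⟨ *-congˡ (*-∑ _ _) ⟩
    sgn (toℕ j) * ∑ (λ k → M zero j * (sgn (toℕ k) * (M (suc zero) (punchIn j k) * det (minor₀₁ M j k))))
      ≈⟨ *-∑ _ _ ⟩
    ∑ (λ k → sgn (toℕ j) * (M zero j * (sgn (toℕ k) * (M (suc zero) (punchIn j k) * det (minor₀₁ M j k)))))
      ≈⟨ ∑-cong (λ k → *-congˡ {x = sgn (toℕ j)} (trans (x∙yz≈y∙xz (M zero j) _ _) (*-congˡ (sym (*-assoc _ _ _))))) ⟩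
    ∑ (λ k → sgn (toℕ j) * (sgn (toℕ k) * expand₂ M j k)) ∎)

  minor₀₁-swap : ∀ {n} (M M′ : Matrix (suc (suc n))) → (∀ i c → M (suc (suc i)) c ≡ M′ (suc (suc i)) c) →
    ∀ {j j′ k k′} → Swap j k j′ k′ → det (minor₀₁ M j k) ≈ det (minor₀₁ M′ j′ k′)
  minor₀₁-swap M M′ eq {j} {j′} {k} {k′} s = det-cong-≡ λ a b →
    ≡.trans (≡.cong (M (suc (suc a))) (swap-columns s b)) (eq a _)

  swapRows₀₁ : ∀ {n} → Matrix (suc (suc n)) → Matrix (suc (suc n))
  swapRows₀₁ M zero          = M (suc zero)
  swapRows₀₁ M (suc zero)    = M zero
  swapRows₀₁ M (suc (suc i)) = M (suc (suc i))

  det-swapRows₀₁ : ∀ {n} (M : Matrix (suc (suc n))) → det M + det (swapRows₀₁ M) ≈ 0#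
  det-swapRows₀₁ M = trans (+-cong (det-expand₂ M) (det-expand₂ (swapRows₀₁ M)))
    (twisted-swap _ _ λ {j} {j′} {k} {k′} s →
      *-cong (trans (*-comm _ _) (*-cong (reflexive (≡.cong (M (suc zero)) (swap-punchIn s)))
                                         (reflexive (≡.cong (M zero) (≡.sym (swap-punchIn (swap-sym s)))))))
             (minor₀₁-swap M (swapRows₀₁ M) (λ _ _ → ≡.refl) s))

  -- A row exchange would give only 2 det M = 0, and 2 may be a zero divisor in R. Here the terms of
  -- the double expansion cancel in pairs.
  det-equalRows₀₁ : ∀ {n} (M : Matrix (suc (suc n))) → (∀ c → M zero c ≈ M (suc zero) c) → det M ≈ 0#
  det-equalRows₀₁ M eq = trans (det-expand₂ M) (twisted-symmetric _ λ {j} {j′} {k} {k′} s →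
    *-cong (trans (*-cong (trans (eq j) (reflexive (≡.cong (M (suc zero)) (≡.sym (swap-punchIn (swap-sym s))))))
                          (trans (reflexive (≡.cong (M (suc zero)) (swap-punchIn s))) (sym (eq j′))))
                  (*-comm _ _))
           (minor₀₁-swap M M (λ _ _ → ≡.refl) s))

  det-minors-zero : ∀ {n} (M : Matrix (suc n)) → (∀ j → det (minor₀ M j) ≈ 0#) → det M ≈ 0#
  det-minors-zero M eq = trans (det-expand M)
    (∑-zero λ j → trans (*-congˡ (trans (*-congˡ (eq j)) (zeroʳ _))) (zeroʳ _))

  det-equalRows-< : ∀ {n} (M : Matrix n) {i k} → i < k → (∀ c → M i c ≈ M k c) → det M ≈ 0#
  det-equalRows-< M {suc i} {suc k} (s≤s i<k) eq = det-minors-zero M λ j →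
    det-equalRows-< (minor₀ M j) i<k (λ c → eq (punchIn j c))
  det-equalRows-< M {zero} {suc zero} i<k eq = det-equalRows₀₁ M eq
  -- Exchanging rows 0 and 1 puts both equal rows below row 0, so every minor in the expansion along
  -- row 0 vanishes by induction.
  det-equalRows-< M {zero} {suc (suc k)} i<k eq = begin
    det M                      ≈⟨ sym (+-identityʳ _) ⟩
    det M + 0#                 ≈⟨ +-congˡ (sym (det-minors-zero (swapRows₀₁ M) (λ j →
                                    det-equalRows-< (minor₀ (swapRows₀₁ M) j) {zero} {suc k} (s≤s z≤n) (λ c → eq (punchIn j c))))) ⟩
    det M + det (swapRows₀₁ M) ≈⟨ det-swapRows₀₁ M ⟩
    0#                         ∎

  det-equalRows : ∀ {n} (M : Matrix n) i k → i ≢ k → (∀ c → M i c ≈ M k c) → det M ≈ 0#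
  det-equalRows M i k i≢k eq with <-cmp i k
  ... | tri< i<k _ _ = det-equalRows-< M i<k eq
  ... | tri≈ _ i≡k _ = ⊥-elim (i≢k i≡k)
  ... | tri> _ _ k<i = det-equalRows-< M k<i (sym ∘ eq)

  minor₀-setRow : ∀ {n} (M : Matrix (suc n)) i r j →
    det (minor₀ (setRow M (suc i) r) j) ≈ det (setRow (minor₀ M j) i (r ∘ punchIn j))
  minor₀-setRow M i r j = det-cong-≡ (setRow-columns (M ∘ suc) i r (punchIn j))

  det-setRow-sum : ∀ {n m} (M : Matrix n) i (c : Fin m → Carrier) (v : Fin m → Fin n → Carrier) →
    det (setRow M i (λ j → ∑ (λ k → c k * v k j))) ≈ ∑ (λ k → c k * det (setRow M i (v k)))
  det-setRow-sum M zero c v = begin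
    det (setRow M zero (λ j → ∑ (λ k → c k * v k j)))
      ≈⟨ det-expand (setRow M zero (λ j → ∑ (λ k → c k * v k j))) ⟩
    ∑ (λ j → e j * (∑ (λ k → c k * v k j) * d j))
      ≈⟨ ∑-cong (λ j → trans (*-congˡ (∑-* _ _)) (*-∑ _ _)) ⟩
    ∑ (λ j → ∑ (λ k → e j * (c k * v k j * d j)))
      ≈⟨ ∑-swap (λ j k → e j * (c k * v k j * d j)) ⟩
    ∑ (λ k → ∑ (λ j → e j * (c k * v k j * d j)))
      ≈⟨ ∑-cong (λ k → ∑-cong (λ j → trans (*-congˡ (*-assoc _ _ _)) (x∙yz≈y∙xz _ _ _))) ⟩
    ∑ (λ k → ∑ (λ j → c k * (e j * (v k j * d j))))
      ≈⟨ ∑-cong (λ k → trans (sym (*-∑ _ _)) (*-congˡ (sym (det-expand (setRow M zero (v k)))))) ⟩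
    ∑ (λ k → c k * det (setRow M zero (v k))) ∎
    where
    e d : _ → Carrier
    e j = sgn (toℕ j)
    d j = det (minor₀ M j)
  det-setRow-sum M (suc i) c v = begin
    det (setRow M (suc i) (λ j → ∑ (λ k → c k * v k j)))
      ≈⟨ det-expand (setRow M (suc i) (λ j → ∑ (λ k → c k * v k j))) ⟩
    ∑ (λ j → e j * (M zero j * det (minor₀ (setRow M (suc i) (λ j → ∑ (λ k → c k * v k j))) j)))
      ≈⟨ ∑-cong (λ j → *-congˡ (*-congˡ (trans (minor₀-setRow M i _ j) (det-setRow-sum (minor₀ M j) i c (λ k → v k ∘ punchIn j))))) ⟩
    ∑ (λ j → e j * (M zero j * ∑ (λ k → c k * d j k)))
      ≈⟨ ∑-cong (λ j → trans (*-congˡ (*-∑ _ _)) (*-∑ _ _)) ⟩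
    ∑ (λ j → ∑ (λ k → e j * (M zero j * (c k * d j k))))
      ≈⟨ ∑-swap (λ j k → e j * (M zero j * (c k * d j k))) ⟩
    ∑ (λ k → ∑ (λ j → e j * (M zero j * (c k * d j k))))
      ≈⟨ ∑-cong (λ k → ∑-cong (λ j → trans (*-congˡ (x∙yz≈y∙xz _ _ _)) (x∙yz≈y∙xz _ _ _))) ⟩
    ∑ (λ k → ∑ (λ j → c k * (e j * (M zero j * d j k))))
      ≈⟨ ∑-cong (λ k → trans (sym (*-∑ _ _)) (*-congˡ (trans
           (∑-cong (λ j → *-congˡ (*-congˡ (sym (minor₀-setRow M i (v k) j))))) (sym (det-expand (setRow M (suc i) (v k))))))) ⟩
    ∑ (λ k → c k * det (setRow M (suc i) (v k))) ∎
    where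
    e : _ → Carrier
    e j = sgn (toℕ j)
    d : _ → _ → Carrier
    d j k = det (setRow (minor₀ M j) i (v k ∘ punchIn j))

  I : ∀ {n} → Matrix n
  I zero    zero    = 1#
  I zero    (suc j) = 0#
  I (suc i) zero    = 0#
  I (suc i) (suc j) = I i j

  ∑-I : ∀ {n} (f : Fin n → Carrier) j → ∑ (λ k → f k * I k j) ≈ f j
  ∑-I {suc n} f zero    = trans (∑-suc _) (trans (+-cong (*-identityʳ _) (∑-zero (λ k → zeroʳ (f (suc k))))) (+-identityʳ _))
  ∑-I {suc n} f (suc j) = trans (∑-suc _) (trans (+-cong (zeroʳ _) (∑-I (f ∘ suc) j)) (+-identityˡ _))

  I-≢ : ∀ {n} (i j : Fin n) → i ≢ j → I i j ≡ 0#
  I-≢ zero    zero    i≢j = ⊥-elim (i≢j ≡.refl)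
  I-≢ zero    (suc j) i≢j = ≡.refl
  I-≢ (suc i) zero    i≢j = ≡.refl
  I-≢ (suc i) (suc j) i≢j = I-≢ i j (i≢j ∘ ≡.cong suc)

  I-refl : ∀ {n} (i : Fin n) → I i i ≡ 1#
  I-refl zero    = ≡.refl
  I-refl (suc i) = I-refl i

  -- The cofactor of entry (i, j), with row `i` replaced by a unit row rather than deleted. Cramer's
  -- rule thereby becomes an instance of linearity in row `i`.
  adjugate : ∀ {n} → Matrix n → Matrix n
  adjugate M j i = det (setRow M i (I j))

  ∑-adjugate : ∀ {n} (M : Matrix n) (r : Fin n → Carrier) i → ∑ (λ j → r j * adjugate M j i) ≈ det (setRow M i r)
  ∑-adjugate M r i = trans (sym (det-setRow-sum M i r I)) (det-cong entry)
    where
    entry : ∀ a b → setRow M i (λ j → ∑ (λ l → r l * I l j)) a b ≈ setRow M i r a b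
    entry a b with i ≟ᶠ a
    ... | yes ≡.refl = trans (reflexive (≡.cong-app (setRow-same M i _) b))
             (trans (∑-I r b) (reflexive (≡.cong-app (≡.sym (setRow-same M i r)) b)))
    ... | no i≢a = reflexive (≡.cong-app (≡.trans (setRow-other M i _ a i≢a) (≡.sym (setRow-other M i r a i≢a))) b)

  -- Row `k` in place of row `i` gives back M when they coincide and a repeated row otherwise.
  *-adjugate : ∀ {n} (M : Matrix n) k i → ∑ (λ j → M k j * adjugate M j i) ≈ det M * I k i
  *-adjugate M k i with k ≟ᶠ i
  ... | yes ≡.refl = trans (∑-adjugate M (M k) k) (trans
          (det-cong-≡ (λ a b → ≡.cong-app (setRow-self M k a) b))
          (trans (sym (*-identityʳ _)) (*-congˡ (reflexive (≡.sym (I-refl k))))))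
  ... | no k≢i = trans (∑-adjugate M (M k) i) (trans
          (det-equalRows _ i k (k≢i ∘ ≡.sym) (λ c → reflexive (≡.cong-app
             (≡.trans (setRow-same M i (M k)) (≡.sym (setRow-other M i (M k) k (k≢i ∘ ≡.sym)))) c)))
          (trans (sym (zeroʳ _)) (*-congˡ (reflexive (≡.sym (I-≢ k i k≢i))))))

  det-I : ∀ n → det (I {n}) ≈ 1#
  det-I zero    = refl
  det-I (suc n) = trans (det-expand (I {suc n})) (trans (trans (∑-suc _)
    (+-cong (trans (*-identityˡ _) (trans (*-identityˡ _) (det-I n)))
            (∑-zero (λ j → trans (*-congˡ (zeroˡ _)) (zeroʳ _)))))
    (+-identityʳ _))

  pow : ∀ {n} → Matrix n → ℕ → Matrix n
  pow A zero    = I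
  pow A (suc k) = λ a b → ∑ (λ c → A a c * pow A k c b)

  trace : ∀ {n} → Matrix n → Carrier
  trace A = ∑ (λ i → A i i)

  module Derivation
    (θ : Carrier → Carrier)
    (θ-cong : ∀ {a b} → a ≈ b → θ a ≈ θ b)
    (θ-0 : θ 0# ≈ 0#) (θ-1 : θ 1# ≈ 0#)
    (θ-neg : ∀ a → θ (- a) ≈ - θ a)
    (θ-+ : ∀ a b → θ (a + b) ≈ θ a + θ b)
    (θ-* : ∀ a b → θ (a * b) ≈ θ a * b + a * θ b) where

    θ-∑ : ∀ {n} (f : Fin n → Carrier) → θ (∑ f) ≈ ∑ (θ ∘ f)
    θ-∑ {zero}  f = trans (θ-cong (∑-empty f)) (trans θ-0 (sym (∑-empty _)))
    θ-∑ {suc n} f = trans (θ-cong (∑-suc f)) (trans (θ-+ _ _) (trans (+-congˡ (θ-∑ (f ∘ suc))) (sym (∑-suc _))))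

    θ-sgn : ∀ k → θ (sgn k) ≈ 0#
    θ-sgn zero    = θ-1
    θ-sgn (suc k) = trans (θ-cong (sgn-suc k)) (trans (θ-neg _) (trans (-‿cong (θ-sgn k)) -0#≈0#))

    θ-sgn* : ∀ k a → θ (sgn k * a) ≈ sgn k * θ a
    θ-sgn* k a = trans (θ-* _ _) (trans (+-congʳ (trans (*-congʳ (θ-sgn k)) (zeroˡ _))) (+-identityˡ _))

    -- Jacobi's formula in row form. A derivation kills the signs, and the Leibniz rule splits each
    -- term of the expansion into a part from row 0 and a part from the minor.
    θ-det : ∀ {n} (M : Matrix n) → θ (det M) ≈ ∑ (λ i → det (setRow M i (θ ∘ M i)))
    θ-det {zero}  M = trans θ-1 (sym (∑-empty _))
    θ-det {suc n} M = begin
      θ (det M)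
        ≈⟨ trans (θ-cong (det-expand M)) (θ-∑ (λ j → e j * (M zero j * d j))) ⟩
      ∑ (λ j → θ (e j * (M zero j * d j)))
        ≈⟨ ∑-cong (λ j → trans (θ-sgn* (toℕ j) _) (trans (*-congˡ (θ-* _ _)) (distribˡ _ _ _))) ⟩
      ∑ (λ j → e j * (θ (M zero j) * d j) + e j * (M zero j * θ (d j)))
        ≈⟨ ∑-+ _ _ ⟩
      ∑ (λ j → e j * (θ (M zero j) * d j)) + ∑ (λ j → e j * (M zero j * θ (d j)))
        ≈⟨ +-cong (sym (det-expand (setRow M zero (θ ∘ M zero)))) rest ⟩
      det (setRow M zero (θ ∘ M zero)) + ∑ (λ i → det (setRow M (suc i) (θ ∘ M (suc i))))
        ≈⟨ sym (∑-suc _) ⟩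
      ∑ (λ i → det (setRow M i (θ ∘ M i))) ∎
      where
      e d : Fin (suc n) → Carrier
      e j = sgn (toℕ j)
      d j = det (minor₀ M j)
      d′ : Fin (suc n) → Fin n → Carrier
      d′ j i = det (minor₀ (setRow M (suc i) (θ ∘ M (suc i))) j)
      rest : ∑ (λ j → e j * (M zero j * θ (d j))) ≈ ∑ (λ i → det (setRow M (suc i) (θ ∘ M (suc i))))
      rest = begin
        ∑ (λ j → e j * (M zero j * θ (d j)))
          ≈⟨ ∑-cong (λ j → *-congˡ (*-congˡ (trans (θ-det (minor₀ M j)) (∑-cong (λ i → sym (minor₀-setRow M i _ j)))))) ⟩
        ∑ (λ j → e j * (M zero j * ∑ (d′ j)))
          ≈⟨ ∑-cong (λ j → trans (*-congˡ (*-∑ _ _)) (*-∑ _ _)) ⟩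
        ∑ (λ j → ∑ (λ i → e j * (M zero j * d′ j i)))
          ≈⟨ ∑-swap (λ j i → e j * (M zero j * d′ j i)) ⟩
        ∑ (λ i → ∑ (λ j → e j * (M zero j * d′ j i)))
          ≈⟨ ∑-cong (λ i → sym (det-expand (setRow M (suc i) (θ ∘ M (suc i))))) ⟩
        ∑ (λ i → det (setRow M (suc i) (θ ∘ M (suc i)))) ∎

-- Formal power series and Newton's identities.

-- The coefficients of Xⁿ p(1/X). A monic `p` of degree `n` turns into a series with constant term
-- 1, which can be cancelled.
reversed : ∀ {A : Set} → A → ℕ → (ℕ → A) → ℕ → A
reversed z n       p zero    = p n
reversed z zero    p (suc j) = z
reversed z (suc n) p (suc j) = reversed z n p j

-- The unit series is a parameter because Defs.1p, being defined by pattern matching,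
-- is not definitionally equal to any series built from R.
module PowerSeries (R : CommutativeRing 0ℓ 0ℓ)
  (1ˢ : ℕ → CommutativeRing.Carrier R)
  (1ˢ-zero : CommutativeRing._≈_ R (1ˢ 0) (CommutativeRing.1# R))
  (1ˢ-suc : ∀ k → CommutativeRing._≈_ R (1ˢ (suc k)) (CommutativeRing.0# R)) where

  open CommutativeRing R hiding (zero)
  open import Algebra.Properties.Ring ring
  open import Algebra.Properties.CommutativeMonoid.Mult +-commutativeMonoid using (×-congʳ; ×-distrib-+) renaming (_×_ to _•_)
  open import Algebra.Properties.Semiring.Mult semiring using (×-comm-*)
  open import Algebra.Properties.CommutativeSemigroup +-commutativeSemigroup using (interchange; x∙yz≈y∙xz)
  import Algebra.Construct.Pointwise ℕ as Pointwise
  open import Relation.Binary.Reasoning.Setoid setoid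
  open Determinant R using (sumF; sign; ∑; ∑-empty; ∑-suc; ∑-cong; ∑-zero; ∑-+; *-∑; ∑-neg; I; ∑-I; det-I; pow; trace) renaming (det to det₁; Matrix to Matrix₁)

  Series : Set
  Series = ℕ → Carrier

  infix  4 _≋_
  infixl 7 _*ˢ_
  infixl 6 _+ˢ_

  _≋_ : Series → Series → Set
  p ≋ q = ∀ k → p k ≈ q k

  0ˢ : Series
  0ˢ k = 0#

  _+ˢ_ _*ˢ_ : Series → Series → Series
  (p +ˢ q) k = p k + q k
  (p *ˢ q) k = sumF {suc k} (λ i → p (toℕ i) * q (k ∸ toℕ i))

  -ˢ_ : Series → Series
  (-ˢ p) k = - p k

  _·_ : Carrier → Series → Series
  (a · p) k = a * p k

  tail : Series → Series
  tail p k = p (suc k)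

  *ˢ-zero : ∀ p q → (p *ˢ q) 0 ≈ p 0 * q 0
  *ˢ-zero p q = +-identityʳ _

  -- By definition the product recurses on its left factor; commutativity and `Ŷ-pow` need the
  -- recursion on the right one.
  *ˢ-sucʳ : ∀ p q k → (p *ˢ q) (suc k) ≈ p (suc k) * q 0 + (p *ˢ tail q) k
  *ˢ-sucʳ p q zero    = x∙yz≈y∙xz _ _ _
  *ˢ-sucʳ p q (suc k) = trans (+-congˡ (*ˢ-sucʳ (tail p) q k)) (x∙yz≈y∙xz _ _ _)

  *ˢ-congˡ-≤ : ∀ p {q q′} k → (∀ i → i ℕ.≤ k → q i ≈ q′ i) → (p *ˢ q) k ≈ (p *ˢ q′) k
  *ˢ-congˡ-≤ p zero    eq = +-congʳ (*-congˡ (eq 0 z≤n))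
  *ˢ-congˡ-≤ p (suc k) eq = +-cong (*-congˡ (eq (suc k) ℕₚ.≤-refl))
    (*ˢ-congˡ-≤ (tail p) k (λ i i≤k → eq i (ℕₚ.m≤n⇒m≤1+n i≤k)))

  *ˢ-congʳ : ∀ {p p′} q → p ≋ p′ → p *ˢ q ≋ p′ *ˢ q
  *ˢ-congʳ q eq zero    = +-congʳ (*-congʳ (eq 0))
  *ˢ-congʳ q eq (suc k) = +-cong (*-congʳ (eq 0)) (*ˢ-congʳ q (eq ∘ suc) k)

  *ˢ-cong : ∀ {p p′ q q′} → p ≋ p′ → q ≋ q′ → p *ˢ q ≋ p′ *ˢ q′
  *ˢ-cong {p′ = p′} {q = q} p≋p′ q≋q′ k = trans (*ˢ-congʳ q p≋p′ k) (*ˢ-congˡ-≤ p′ k (λ i _ → q≋q′ i))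

  *ˢ-comm : ∀ p q → p *ˢ q ≋ q *ˢ p
  *ˢ-comm p q zero    = +-congʳ (*-comm _ _)
  *ˢ-comm p q (suc k) = trans (+-cong (*-comm _ _) (*ˢ-comm (tail p) q k)) (sym (*ˢ-sucʳ q p k))

  0ˢ-*ˢ : ∀ q → 0ˢ *ˢ q ≋ 0ˢ
  0ˢ-*ˢ q zero    = trans (+-identityʳ _) (zeroˡ _)
  0ˢ-*ˢ q (suc k) = trans (+-cong (zeroˡ _) (0ˢ-*ˢ q k)) (+-identityʳ _)

  *ˢ-identityˡ : ∀ q → 1ˢ *ˢ q ≋ q
  *ˢ-identityˡ q zero    = trans (+-identityʳ _) (trans (*-congʳ 1ˢ-zero) (*-identityˡ _))
  *ˢ-identityˡ q (suc k) = trans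
    (+-cong (trans (*-congʳ 1ˢ-zero) (*-identityˡ _)) (trans (*ˢ-congʳ q 1ˢ-suc k) (0ˢ-*ˢ q k)))
    (+-identityʳ _)

  *ˢ-distribʳ : ∀ r p q → (p +ˢ q) *ˢ r ≋ p *ˢ r +ˢ q *ˢ r
  *ˢ-distribʳ r p q zero    = trans (+-identityʳ _) (trans (distribʳ _ _ _) (sym (+-cong (+-identityʳ _) (+-identityʳ _))))
  *ˢ-distribʳ r p q (suc k) = trans (+-cong (distribʳ _ _ _) (*ˢ-distribʳ r (tail p) (tail q) k)) (interchange _ _ _ _)

  *ˢ-distribˡ : ∀ r p q → r *ˢ (p +ˢ q) ≋ r *ˢ p +ˢ r *ˢ q
  *ˢ-distribˡ r p q k = trans (*ˢ-comm r (p +ˢ q) k)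
    (trans (*ˢ-distribʳ r p q k) (+-cong (*ˢ-comm p r k) (*ˢ-comm q r k)))

  ·-*ˢ : ∀ a p q → (a · p) *ˢ q ≋ a · (p *ˢ q)
  ·-*ˢ a p q zero    = trans (+-identityʳ _) (trans (*-assoc _ _ _) (*-congˡ (sym (+-identityʳ _))))
  ·-*ˢ a p q (suc k) = trans (+-cong (*-assoc _ _ _) (·-*ˢ a (tail p) q k)) (sym (distribˡ _ _ _))

  *ˢ-· : ∀ a p q → p *ˢ (a · q) ≋ a · (p *ˢ q)
  *ˢ-· a p q k = trans (*ˢ-comm p (a · q) k) (trans (·-*ˢ a q p k) (*-congˡ (*ˢ-comm q p k)))

  *ˢ-assoc : ∀ p q r → (p *ˢ q) *ˢ r ≋ p *ˢ (q *ˢ r)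
  *ˢ-assoc p q r zero    = begin
    ((p *ˢ q) *ˢ r) 0 ≈⟨ *ˢ-zero (p *ˢ q) r ⟩
    (p *ˢ q) 0 * r 0  ≈⟨ *-congʳ (*ˢ-zero p q) ⟩
    p 0 * q 0 * r 0   ≈⟨ *-assoc _ _ _ ⟩
    p 0 * (q 0 * r 0) ≈⟨ *-congˡ (sym (*ˢ-zero q r)) ⟩
    p 0 * (q *ˢ r) 0  ≈⟨ sym (*ˢ-zero p (q *ˢ r)) ⟩
    (p *ˢ (q *ˢ r)) 0 ∎
  *ˢ-assoc p q r (suc k) = begin
    (p *ˢ q) 0 * r (suc k) + (tail (p *ˢ q) *ˢ r) k
      ≈⟨ +-cong (trans (*-congʳ (*ˢ-zero p q)) (*-assoc _ _ _))
                (*ˢ-distribʳ r (p 0 · tail q) (tail p *ˢ q) k) ⟩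
    p 0 * (q 0 * r (suc k)) + (((p 0 · tail q) *ˢ r) k + ((tail p *ˢ q) *ˢ r) k)
      ≈⟨ +-congˡ (+-cong (·-*ˢ (p 0) (tail q) r k) (*ˢ-assoc (tail p) q r k)) ⟩
    p 0 * (q 0 * r (suc k)) + (p 0 * (tail q *ˢ r) k + (tail p *ˢ (q *ˢ r)) k)
      ≈⟨ sym (+-assoc _ _ _) ⟩
    p 0 * (q 0 * r (suc k)) + p 0 * (tail q *ˢ r) k + (tail p *ˢ (q *ˢ r)) k
      ≈⟨ +-congʳ (sym (distribˡ _ _ _)) ⟩
    p 0 * (q *ˢ r) (suc k) + (tail p *ˢ (q *ˢ r)) k ∎

  seriesRing : CommutativeRing 0ℓ 0ℓ
  seriesRing = record
    { Carrier = Series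
    ; _≈_ = _≋_
    ; _+_ = _+ˢ_
    ; _*_ = _*ˢ_
    ; -_ = -ˢ_
    ; 0# = 0ˢ
    ; 1# = 1ˢ
    ; isCommutativeRing = record
      { isRing = record
        { +-isAbelianGroup = Pointwise.isAbelianGroup +-isAbelianGroup
        ; *-cong = *ˢ-cong
        ; *-assoc = *ˢ-assoc
        ; *-identity = *ˢ-identityˡ , λ q k → trans (*ˢ-comm q 1ˢ k) (*ˢ-identityˡ q k)
        ; distrib = *ˢ-distribˡ , *ˢ-distribʳ
        }
      ; *-comm = *ˢ-comm
      }
    }

  -- θ = X d/dX: unlike d/dX it does not shift the coefficients.
  θ : Series → Series
  θ p k = k • p k

  ×-0# : ∀ k → k • 0# ≈ 0#
  ×-0# zero    = refl
  ×-0# (suc k) = trans (+-identityˡ _) (×-0# k)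

  ×-neg : ∀ k a → k • (- a) ≈ - (k • a)
  ×-neg zero    a = sym -0#≈0#
  ×-neg (suc k) a = trans (+-congˡ (×-neg k a)) (-‿+-comm a (k • a))

  θ-1ˢ : θ 1ˢ ≋ 0ˢ
  θ-1ˢ zero    = refl
  θ-1ˢ (suc k) = trans (×-congʳ (suc k) (1ˢ-suc k)) (×-0# (suc k))

  θ-*ˢ : ∀ p q → θ (p *ˢ q) ≋ θ p *ˢ q +ˢ p *ˢ θ q
  θ-*ˢ p q zero    = sym (trans (+-cong (trans (+-identityʳ _) (zeroˡ _)) (trans (+-identityʳ _) (zeroʳ _))) (+-identityʳ _))
  θ-*ˢ p q (suc k) = begin
    suc k • (p 0 * q (suc k) + (tail p *ˢ q) k)
      ≈⟨ ×-distrib-+ _ _ (suc k) ⟩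
    suc k • (p 0 * q (suc k)) + ((tail p *ˢ q) k + k • (tail p *ˢ q) k)
      ≈⟨ +-cong (sym (×-comm-* (suc k) _ _)) (+-congˡ (θ-*ˢ (tail p) q k)) ⟩
    p 0 * θ q (suc k) + ((tail p *ˢ q) k + ((θ (tail p) *ˢ q) k + (tail p *ˢ θ q) k))
      ≈⟨ +-congˡ (sym (+-assoc _ _ _)) ⟩
    p 0 * θ q (suc k) + ((tail p *ˢ q) k + (θ (tail p) *ˢ q) k + (tail p *ˢ θ q) k)
      ≈⟨ x∙yz≈y∙xz _ _ _ ⟩
    (tail p *ˢ q) k + (θ (tail p) *ˢ q) k + (p 0 * θ q (suc k) + (tail p *ˢ θ q) k)
      ≈⟨ +-congʳ (sym (*ˢ-distribʳ q (tail p) (θ (tail p)) k)) ⟩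
    (tail (θ p) *ˢ q) k + (p 0 * θ q (suc k) + (tail p *ˢ θ q) k)
      ≈⟨ +-congʳ (sym (trans (+-congʳ (zeroˡ _)) (+-identityˡ _))) ⟩
    0# * q (suc k) + (tail (θ p) *ˢ q) k + (p 0 * θ q (suc k) + (tail p *ˢ θ q) k) ∎

  module S = Determinant seriesRing
  open S using (det; Matrix; adjugate)
  open S.Derivation θ (λ eq k → ×-congʳ k (eq k)) (λ k → ×-0# k) θ-1ˢ (λ p k → ×-neg k (p k))
    (λ p q k → ×-distrib-+ (p k) (q k) k) θ-*ˢ using (θ-det)

  ∑-coeff : ∀ {n} (f : Fin n → Series) k → S.∑ f k ≈ ∑ (λ j → f j k)
  ∑-coeff {zero}  f k = trans (S.∑-empty f k) (sym (∑-empty _))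
  ∑-coeff {suc n} f k = trans (S.∑-suc f k) (trans (+-congˡ (∑-coeff (f ∘ suc) k)) (sym (∑-suc _)))

  sign-coeff : ∀ m p k → S.sign m p k ≡ sign m (p k)
  sign-coeff zero          p k = ≡.refl
  sign-coeff (suc zero)    p k = ≡.refl
  sign-coeff (suc (suc m)) p k = sign-coeff m p k

  sign-cong : ∀ m {a b} → a ≈ b → sign m a ≈ sign m b
  sign-cong zero          eq = eq
  sign-cong (suc zero)    eq = -‿cong eq
  sign-cong (suc (suc m)) eq = sign-cong m eq

  sign-0# : ∀ m → sign m 0# ≈ 0#
  sign-0# zero          = refl
  sign-0# (suc zero)    = -0#≈0#
  sign-0# (suc (suc m)) = sign-0# m

  det-coeff : ∀ {n} (M : Matrix (suc n)) k →
    det M k ≈ ∑ (λ j → sign (toℕ j) ((M zero j *ˢ det (S.minor₀ M j)) k))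
  det-coeff M k = trans (S.sumF≈∑ (λ j → S.sign (toℕ j) (M zero j *ˢ det (S.minor₀ M j))) k)
    (trans (∑-coeff _ k) (∑-cong (λ j → reflexive (sign-coeff (toℕ j) (M zero j *ˢ det (S.minor₀ M j)) k))))

  Linear : Series → Set
  Linear p = ∀ k → p (suc (suc k)) ≈ 0#

  linear-*ˢ : ∀ p → Linear p → ∀ q k → (p *ˢ q) (suc k) ≈ p 0 * q (suc k) + p 1 * q k
  linear-*ˢ p lin q zero    = +-congˡ (+-identityʳ _)
  linear-*ˢ p lin q (suc k) = +-congˡ (trans (+-congˡ (trans (*ˢ-congʳ q lin k) (0ˢ-*ˢ q k))) (+-identityʳ _))

  det-degree : ∀ {n} (M : Matrix n) → (∀ i j → Linear (M i j)) → ∀ k → n ℕ.< k → det M k ≈ 0#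
  det-degree {zero}  M lin (suc k) n<k = 1ˢ-suc k
  det-degree {suc n} M lin (suc k) (s≤s n<k) = trans (det-coeff M (suc k)) (∑-zero λ j →
    trans (sign-cong (toℕ j) (trans (linear-*ˢ (M zero j) (lin zero j) (det (S.minor₀ M j)) k)
      (trans (+-cong (trans (*-congˡ (vanish j (suc k) (ℕₚ.m<n⇒m<1+n n<k))) (zeroʳ _)) (trans (*-congˡ (vanish j k n<k)) (zeroʳ _)))
        (+-identityʳ _))))
      (sign-0# (toℕ j)))
    where
    vanish : ∀ j k → n ℕ.< k → det (S.minor₀ M j) k ≈ 0#
    vanish j = det-degree (S.minor₀ M j) (λ a b → lin (suc a) (punchIn j b))

  -- Degree `n` arises only by taking the linear coefficient in each of the `n` rows.
  det-leading : ∀ {n} (M : Matrix n) → (∀ i j → Linear (M i j)) → det M n ≈ det₁ (λ i j → M i j 1)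
  det-leading {zero}  M lin = 1ˢ-zero
  det-leading {suc n} M lin = trans (det-coeff M (suc n)) (trans (∑-cong λ j →
    sign-cong (toℕ j) (trans (linear-*ˢ (M zero j) (lin zero j) (det (S.minor₀ M j)) n)
      (trans (+-cong (trans (*-congˡ (det-degree (S.minor₀ M j) (λ a b → lin (suc a) (punchIn j b)) (suc n) ℕₚ.≤-refl)) (zeroʳ _))
                     (*-congˡ (det-leading (S.minor₀ M j) (λ a b → lin (suc a) (punchIn j b)))))
        (+-identityˡ _))))
    (sym (Determinant.sumF≈∑ R (λ j → sign (toℕ j) (M zero j 1 * det₁ (λ a b → M (suc a) (punchIn j b) 1))))))

  *ˢ-∑ : ∀ {n} p (s : Fin n → Series) k → (p *ˢ (λ j → ∑ (λ c → s c j))) k ≈ ∑ (λ c → (p *ˢ s c) k)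
  *ˢ-∑ p s zero    = trans (+-identityʳ _) (trans (*-∑ _ _) (∑-cong (λ c → sym (+-identityʳ _))))
  *ˢ-∑ p s (suc k) = trans (+-cong (*-∑ _ _) (*ˢ-∑ (tail p) s k)) (sym (∑-+ _ _))

  *ˢ-I : ∀ {n} p (i j : Fin n) → p *ˢ S.I i j ≋ I i j · p
  *ˢ-I p zero    zero    k = trans (trans (*ˢ-comm p 1ˢ k) (*ˢ-identityˡ p k)) (sym (*-identityˡ _))
  *ˢ-I p zero    (suc j) k = trans (trans (*ˢ-comm p 0ˢ k) (0ˢ-*ˢ p k)) (sym (zeroˡ _))
  *ˢ-I p (suc i) zero    k = trans (trans (*ˢ-comm p 0ˢ k) (0ˢ-*ˢ p k)) (sym (zeroˡ _))
  *ˢ-I p (suc i) (suc j) k = *ˢ-I p i j k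

  I-linear : ∀ {n} (i j : Fin n) → Linear (S.I i j)
  I-linear zero    zero    k = 1ˢ-suc (suc k)
  I-linear zero    (suc j) k = refl
  I-linear (suc i) zero    k = refl
  I-linear (suc i) (suc j) k = I-linear i j k

  -- L plays the role of X I − A.
  record Characteristic {n} (A : Matrix₁ n) (L : Matrix n) : Set where
    field
      constant : ∀ i j → L i j 0 ≈ - A i j
      leading  : ∀ i j → L i j 1 ≈ I i j
      linear   : ∀ i j → Linear (L i j)

  module Newton {n} {A : Matrix₁ n} {L : Matrix n} (char : Characteristic A L) where

    open Characteristic char

    p : Series
    p = det L

    -- X adj (X I − A)
    Y : ℕ → Matrix₁ n
    Y zero    i j = 0#
    Y (suc k) i j = adjugate L i j k

    p-leading : p n ≈ 1#
    p-leading = trans (det-leading L linear) (trans (Determinant.det-cong R leading) (det-I n))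

    p-degree : ∀ k → n ℕ.< k → p k ≈ 0#
    p-degree = det-degree L linear

    L-*ˢ-zero : ∀ i j q → (L i j *ˢ q) 0 ≈ - (A i j * q 0)
    L-*ˢ-zero i j q = trans (+-identityʳ _) (trans (*-congʳ (constant i j)) (sym (-‿distribˡ-* _ _)))

    L-*ˢ-suc : ∀ i j q k → (L i j *ˢ q) (suc k) ≈ - (A i j * q (suc k)) + q k * I i j
    L-*ˢ-suc i j q k = trans (linear-*ˢ (L i j) (linear i j) q k)
      (+-cong (trans (*-congʳ (constant i j)) (sym (-‿distribˡ-* _ _))) (trans (*-congʳ (leading i j)) (*-comm _ _)))

    L*adj-coeff : ∀ k i j → ∑ (λ c → (L i c *ˢ adjugate L c j) k) ≈ p k * I i j
    L*adj-coeff k i j = trans (sym (∑-coeff _ k)) (trans (S.*-adjugate L i j k) (trans (*ˢ-I p i j k) (*-comm _ _)))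

    I-sym : ∀ {m} (i j : Fin m) → I i j ≡ I j i
    I-sym zero    zero    = ≡.refl
    I-sym zero    (suc j) = ≡.refl
    I-sym (suc i) zero    = ≡.refl
    I-sym (suc i) (suc j) = I-sym i j

    -- The coefficient of Xᵏ in (X I - A) adj (X I - A) = p I. The extra factor X in `Y` makes the
    -- constant term an instance of the same formula, with `Y 0` = 0.
    Y-step : ∀ k i j → Y k i j ≈ ∑ (λ c → A i c * Y (suc k) c j) + p k * I i j
    Y-step zero i j = sym (trans (+-congˡ (trans (sym (L*adj-coeff 0 i j))
      (trans (∑-cong (λ c → L-*ˢ-zero i c (adjugate L c j))) (∑-neg _)))) (-‿inverseʳ _))
    Y-step (suc k) i j = begin
      y
        ≈⟨ sym (+-identityˡ _) ⟩
      0# + y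
        ≈⟨ +-congʳ (sym (-‿inverseʳ _)) ⟩
      a + - a + y
        ≈⟨ +-assoc _ _ _ ⟩
      a + (- a + y)
        ≈⟨ +-congˡ (+-cong (sym (∑-neg _)) (trans (sym (∑-I (λ c → adjugate L c j k) i))
             (∑-cong (λ c → *-congˡ (reflexive (I-sym c i)))))) ⟩
      a + (∑ (λ c → - (A i c * Y (suc (suc k)) c j)) + ∑ (λ c → adjugate L c j k * I i c))
        ≈⟨ +-congˡ (sym (∑-+ _ _)) ⟩
      a + ∑ (λ c → - (A i c * Y (suc (suc k)) c j) + adjugate L c j k * I i c)
        ≈⟨ +-congˡ (∑-cong (λ c → sym (L-*ˢ-suc i c (adjugate L c j) k))) ⟩
      a + ∑ (λ c → (L i c *ˢ adjugate L c j) (suc k))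
        ≈⟨ +-congˡ (L*adj-coeff (suc k) i j) ⟩
      a + p (suc k) * I i j ∎
      where
      y = Y (suc k) i j
      a = ∑ (λ c → A i c * Y (suc (suc k)) c j)

    setRow-linear : ∀ j i a b → Linear (setRow L i (S.I j) a b)
    setRow-linear j i a b with i ≟ᶠ a
    ... | yes ≡.refl = λ k → trans (reflexive (≡.cong (λ r → r b (suc (suc k))) (setRow-same L i (S.I j)))) (I-linear j b k)
    ... | no i≢a     = λ k → trans (reflexive (≡.cong (λ r → r b (suc (suc k))) (setRow-other L i (S.I j) a i≢a))) (linear a b k)

    -- As determinants of order `n` with linear entries, the adjugate entries have degree at most
    -- `n`. The recursion improves this bound by one.
    Y-vanish : ∀ i j → Y (suc n) i j ≈ 0#
    Y-vanish i j = trans (Y-step (suc n) i j) (trans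
      (+-cong (∑-zero (λ c → trans (*-congˡ (det-degree _ (setRow-linear c j) (suc n) ℕₚ.≤-refl)) (zeroʳ _)))
              (trans (*-congʳ (p-degree (suc n) ℕₚ.≤-refl)) (zeroˡ _)))
      (+-identityʳ _))

    Y-leading : ∀ i j → Y n i j ≈ I i j
    Y-leading i j = trans (Y-step n i j) (trans
      (+-cong (∑-zero (λ c → trans (*-congˡ (Y-vanish c j)) (zeroʳ _))) (trans (*-congʳ p-leading) (*-identityˡ _)))
      (+-identityˡ _))

    θL-linear : ∀ i j → Linear (θ (L i j))
    θL-linear i j k = trans (×-congʳ (suc (suc k)) (linear i j k)) (×-0# (suc (suc k)))

    θL-*ˢ-suc : ∀ i j q k → (θ (L i j) *ˢ q) (suc k) ≈ q k * I i j
    θL-*ˢ-suc i j q k = trans (linear-*ˢ (θ (L i j)) (θL-linear i j) q k)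
      (trans (+-cong (zeroˡ _) (trans (*-congʳ (trans (+-identityʳ _) (leading i j))) (*-comm _ _))) (+-identityˡ _))

    θ-p : ∀ k → θ p k ≈ ∑ (λ i → ∑ (λ c → (θ (L i c) *ˢ adjugate L c i) k))
    θ-p k = trans (θ-det L k) (trans (∑-coeff _ k) (∑-cong (λ i →
      trans (sym (S.∑-adjugate L (λ j → θ (L i j)) i k)) (∑-coeff _ k))))

    -- By Jacobi's formula θ p is the trace of (θ L) adj L, and θ turns X I - A into X I.
    trace-Y : ∀ k → trace (Y k) ≈ θ p k
    trace-Y zero    = ∑-zero (λ i → refl)
    trace-Y (suc k) = sym (trans (θ-p (suc k)) (∑-cong (λ i →
      trans (∑-cong (λ c → trans (θL-*ˢ-suc i c (adjugate L c i) k) (*-congˡ (reflexive (I-sym i c))))) (∑-I (λ c → adjugate L c i k) i))))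

    p̂ : Series
    p̂ = reversed 0# n p

    Ŷ : ℕ → Matrix₁ n
    Ŷ = reversed (λ _ _ → 0#) n Y

    -- Read from the top coefficient downwards, `Y-step` is Horner's scheme for evaluating p at A.
    reversed-step : ∀ m k i j → reversed (λ _ _ → 0#) m Y (suc k) i j ≈
      ∑ (λ c → A i c * reversed (λ _ _ → 0#) m Y k c j) + reversed 0# m p (suc k) * I i j
    -- Beyond the last coefficient everything is 0; the first such step also uses that `Y 0` is 0.
    reversed-step zero    zero    i j = sym (trans (+-cong (∑-zero (λ c → zeroʳ _)) (zeroˡ _)) (+-identityʳ _))
    reversed-step zero    (suc k) i j = sym (trans (+-cong (∑-zero (λ c → zeroʳ _)) (zeroˡ _)) (+-identityʳ _))
    reversed-step (suc m) zero    i j = Y-step m i j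
    reversed-step (suc m) (suc k) i j = reversed-step m k i j

    -- This is `trace-Y` at index m - k, with the term in `k` moved to the left to avoid
    -- subtraction.
    reversed-trace : ∀ m k → trace (reversed (λ _ _ → 0#) m Y k) + k • reversed 0# m p k ≈ m • reversed 0# m p k
    reversed-trace m       zero    = trans (+-identityʳ _) (trace-Y m)
    reversed-trace zero    (suc k) = trans (+-cong (∑-zero (λ i → refl)) (×-0# (suc k))) (+-identityʳ _)
    reversed-trace (suc m) (suc k) = trans (x∙yz≈y∙xz _ _ _) (+-congˡ (reversed-trace m k))

    p̂-zero : p̂ 0 ≈ 1#
    p̂-zero = p-leading

    -- As generating functions: adj (I - X A) = det (I - X A) · Σ Aˡ Xˡ.
    Ŷ-pow : ∀ k i j → Ŷ k i j ≈ (p̂ *ˢ (λ l → pow A l i j)) k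
    Ŷ-pow zero    i j = trans (Y-leading i j) (sym (trans (+-identityʳ _) (trans (*-congʳ p̂-zero) (*-identityˡ _))))
    Ŷ-pow (suc k) i j = begin
      Ŷ (suc k) i j
        ≈⟨ reversed-step n k i j ⟩
      ∑ (λ c → A i c * Ŷ k c j) + p̂ (suc k) * I i j
        ≈⟨ +-comm _ _ ⟩
      p̂ (suc k) * I i j + ∑ (λ c → A i c * Ŷ k c j)
        ≈⟨ +-congˡ (∑-cong (λ c → trans (*-congˡ (Ŷ-pow k c j)) (sym (*ˢ-· (A i c) p̂ (λ l → pow A l c j) k)))) ⟩
      p̂ (suc k) * I i j + ∑ (λ c → (p̂ *ˢ (A i c · (λ l → pow A l c j))) k)
        ≈⟨ +-congˡ (sym (*ˢ-∑ p̂ (λ c → A i c · (λ l → pow A l c j)) k)) ⟩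
      p̂ (suc k) * I i j + (p̂ *ˢ (λ l → pow A (suc l) i j)) k
        ≈⟨ sym (*ˢ-sucʳ p̂ (λ l → pow A l i j) k) ⟩
      (p̂ *ˢ (λ l → pow A l i j)) (suc k) ∎

    powerSum : Series
    powerSum k = trace (pow A k)

    newton : ∀ k → (p̂ *ˢ powerSum) k + k • p̂ k ≈ n • p̂ k
    newton k = trans (+-congʳ (trans (*ˢ-∑ p̂ (λ i l → pow A l i i) k) (∑-cong (λ i → sym (Ŷ-pow k i i)))))
      (reversed-trace n k)

  reversed-cong : ∀ {p q} → p ≋ q → ∀ n → reversed 0# n p ≋ reversed 0# n q
  reversed-cong eq n       zero    = eq n
  reversed-cong eq zero    (suc k) = refl
  reversed-cong eq (suc n) (suc k) = reversed-cong eq n k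

  *ˢ-cancelˡ : ∀ p q r → p 0 ≈ 1# → p *ˢ q ≋ p *ˢ r → q ≋ r
  *ˢ-cancelˡ p q r p₀ eq k = below k k ℕₚ.≤-refl
    where
    unit : ∀ a b → a ≈ b → ∀ {x y} → p 0 * x + a ≈ p 0 * y + b → x ≈ y
    unit a b a≈b {x} {y} h = trans (sym (trans (*-congʳ p₀) (*-identityˡ _)))
      (trans (+-cancelʳ a _ _ (trans h (+-congˡ (sym a≈b)))) (trans (*-congʳ p₀) (*-identityˡ _)))
    below : ∀ k i → i ℕ.≤ k → q i ≈ r i
    below zero    zero z≤n = unit 0# 0# refl (eq 0)
    below (suc k) i i≤1+k with ℕₚ.m≤n⇒m<n∨m≡n i≤1+k
    ... | inj₁ (s≤s i≤k) = below k i i≤k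
    -- Apart from p 0 · q (k + 1), the coefficient of index k + 1 involves `q` only up to index `k`.
    ... | inj₂ ≡.refl    = unit _ _ (*ˢ-congˡ-≤ (tail p) k (below k)) (eq (suc k))

  powerSums-determined : ∀ {n} {A A′ : Matrix₁ n} {L L′ : Matrix n} → Characteristic A L → Characteristic A′ L′ →
    det L ≋ det L′ → ∀ k → trace (pow A k) ≈ trace (pow A′ k)
  powerSums-determined {n} c c′ eq = *ˢ-cancelˡ N.p̂ N.powerSum N′.powerSum N.p̂-zero λ k →
    +-cancelʳ (k • N.p̂ k) _ _ (trans (N.newton k) (trans (×-congʳ n (p̂≋ k)) (trans (sym (N′.newton k))
      (+-cong (*ˢ-congʳ N′.powerSum (λ j → sym (p̂≋ j)) k) (×-congʳ k (sym (p̂≋ k)))))))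
    where
    module N = Newton c
    module N′ = Newton c′
    p̂≋ = reversed-cong eq n

  -- The polynomial of the larger matrix has coefficient 1 in a degree where the other one has 0.
  sizes-equal : ∀ {n m} {A : Matrix₁ n} {A′ : Matrix₁ m} {L L′} → ¬ (0# ≈ 1#) → Characteristic A L → Characteristic A′ L′ →
    det L ≋ det L′ → n ≡ m
  sizes-equal {n} {m} 0≉1 c c′ eq with ℕₚ.<-cmp n m
  ... | tri< n<m _ _ = ⊥-elim (0≉1 (trans (sym (Newton.p-degree c m n<m)) (trans (eq m) (Newton.p-leading c′))))
  ... | tri≈ _ n≡m _ = n≡m
  ... | tri> _ _ m<n = ⊥-elim (0≉1 (trans (sym (Newton.p-degree c′ n m<n)) (trans (sym (eq n)) (Newton.p-leading c))))

-- The sum over all 3 × 3 minors as a polynomial in traces.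

module ThreeMinors (R : CommutativeRing 0ℓ 0ℓ) where

  open CommutativeRing R hiding (zero)
  open import Algebra.Properties.Ring ring
  open import Algebra.Properties.CommutativeSemigroup *-commutativeSemigroup
  import Algebra.Properties.CommutativeSemigroup +-commutativeSemigroup as +ₚ
  open import Algebra.Solver.CommutativeMonoid +-commutativeMonoid using (solve; _⊕_; _⊜_)
  open import Relation.Binary.Reasoning.Setoid setoid
  open Determinant R

  -- A signed sum over the symmetric group S₃: three even permutations, then three odd ones.
  alt : (e₁ e₂ e₃ o₁ o₂ o₃ : Carrier) → Carrier
  alt e₁ e₂ e₃ o₁ o₂ o₃ = (e₁ + e₂ + e₃) + - (o₁ + o₂ + o₃)

  alt-cong : ∀ {e₁ e₂ e₃ o₁ o₂ o₃ e₁′ e₂′ e₃′ o₁′ o₂′ o₃′} →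
    e₁ ≈ e₁′ → e₂ ≈ e₂′ → e₃ ≈ e₃′ → o₁ ≈ o₁′ → o₂ ≈ o₂′ → o₃ ≈ o₃′ →
    alt e₁ e₂ e₃ o₁ o₂ o₃ ≈ alt e₁′ e₂′ e₃′ o₁′ o₂′ o₃′
  alt-cong a b c d e f = +-cong (+-cong (+-cong a b) c) (-‿cong (+-cong (+-cong d e) f))

  alt-rotate : ∀ e₁ e₂ e₃ o₁ o₂ o₃ → alt e₃ e₁ e₂ o₂ o₃ o₁ ≈ alt e₁ e₂ e₃ o₁ o₂ o₃
  alt-rotate e₁ e₂ e₃ o₁ o₂ o₃ = +-cong (+ₚ.xy∙z≈yz∙x e₃ e₁ e₂) (-‿cong (+ₚ.xy∙z≈zx∙y o₂ o₃ o₁))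

  alt-swap : ∀ e₁ e₂ e₃ o₁ o₂ o₃ → alt o₁ o₂ o₃ e₁ e₂ e₃ ≈ - alt e₁ e₂ e₃ o₁ o₂ o₃
  alt-swap e₁ e₂ e₃ o₁ o₂ o₃ = trans (trans (+-comm _ _) (+-congˡ (sym (-‿involutive _)))) (-‿+-comm _ _)

  *-alt : ∀ a e₁ e₂ e₃ o₁ o₂ o₃ → a * alt e₁ e₂ e₃ o₁ o₂ o₃ ≈ alt (a * e₁) (a * e₂) (a * e₃) (a * o₁) (a * o₂) (a * o₃)
  *-alt a e₁ e₂ e₃ o₁ o₂ o₃ = trans (distribˡ _ _ _)
    (+-cong (sum₃ e₁ e₂ e₃) (trans (sym (-‿distribʳ-* _ _)) (-‿cong (sum₃ o₁ o₂ o₃))))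
    where
    sum₃ : ∀ x y z → a * (x + y + z) ≈ a * x + a * y + a * z
    sum₃ x y z = trans (distribˡ _ _ _) (+-congʳ (distribˡ _ _ _))

  ∑-alt : ∀ {n} (e₁ e₂ e₃ o₁ o₂ o₃ : Fin n → Carrier) →
    ∑ (λ i → alt (e₁ i) (e₂ i) (e₃ i) (o₁ i) (o₂ i) (o₃ i)) ≈ alt (∑ e₁) (∑ e₂) (∑ e₃) (∑ o₁) (∑ o₂) (∑ o₃)
  ∑-alt e₁ e₂ e₃ o₁ o₂ o₃ = trans (∑-+ _ _) (+-cong (sum₃ e₁ e₂ e₃) (trans (∑-neg _) (-‿cong (sum₃ o₁ o₂ o₃))))
    where
    sum₃ : ∀ f g h → ∑ (λ i → f i + g i + h i) ≈ ∑ f + ∑ g + ∑ h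
    sum₃ f g h = trans (∑-+ _ _) (+-congʳ (∑-+ _ _))

  module _ {n : ℕ} where

    Vector : Set
    Vector = Fin n → Carrier

    Tensor : Set
    Tensor = Fin n → Fin n → Fin n → Carrier

    ∑³ : Tensor → Carrier
    ∑³ f = ∑ (λ i → ∑ (λ j → ∑ (λ k → f i j k)))

    ∑³-cong : {f g : Tensor} → (∀ i j k → f i j k ≈ g i j k) → ∑³ f ≈ ∑³ g
    ∑³-cong eq = ∑-cong (λ i → ∑-cong (λ j → ∑-cong (eq i j)))

    ∑³-alt : (e₁ e₂ e₃ o₁ o₂ o₃ : Tensor) →
      ∑³ (λ i j k → alt (e₁ i j k) (e₂ i j k) (e₃ i j k) (o₁ i j k) (o₂ i j k) (o₃ i j k)) ≈
      alt (∑³ e₁) (∑³ e₂) (∑³ e₃) (∑³ o₁) (∑³ o₂) (∑³ o₃)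
    ∑³-alt e₁ e₂ e₃ o₁ o₂ o₃ = trans (∑-cong (λ i → trans (∑-cong (λ j → ∑-alt _ _ _ _ _ _)) (∑-alt _ _ _ _ _ _))) (∑-alt _ _ _ _ _ _)

    ∑³-neg : (f : Tensor) → ∑³ (λ i j k → - f i j k) ≈ - ∑³ f
    ∑³-neg f = trans (∑-cong (λ i → trans (∑-cong (λ j → ∑-neg _)) (∑-neg _))) (∑-neg _)

    ∑³-swap₂₃ : (f : Tensor) → ∑³ (λ i j k → f i k j) ≈ ∑³ f
    ∑³-swap₂₃ f = ∑-cong (λ i → ∑-swap (λ j k → f i k j))

    ∑³-swap₁₂ : (f : Tensor) → ∑³ (λ i j k → f j i k) ≈ ∑³ f
    ∑³-swap₁₂ f = ∑-swap (λ i j → ∑ (λ k → f j i k))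

    ∑³-rotate : (f : Tensor) → ∑³ (λ i j k → f j k i) ≈ ∑³ f
    ∑³-rotate f = trans (∑³-swap₁₂ (λ i j k → f i k j)) (∑³-swap₂₃ f)

    ∑³-product : (u v w : Vector) → ∑³ (λ i j k → u i * v j * w k) ≈ ∑ u * ∑ v * ∑ w
    ∑³-product u v w = sym (begin
      ∑ u * ∑ v * ∑ w                                  ≈⟨ *-congʳ (trans (∑-* _ _) (∑-cong (λ i → *-∑ _ _))) ⟩
      ∑ (λ i → ∑ (λ j → u i * v j)) * ∑ w              ≈⟨ ∑-* _ _ ⟩
      ∑ (λ i → ∑ (λ j → u i * v j) * ∑ w)              ≈⟨ ∑-cong (λ i → trans (∑-* _ _) (∑-cong (λ j → *-∑ _ _))) ⟩
      ∑ (λ i → ∑ (λ j → ∑ (λ k → u i * v j * w k)))    ∎)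

    _⊗_⊗_ : Vector → Vector → Vector → Tensor
    (u ⊗ v ⊗ w) i j k = u i * v j * w k

    -- Entry (i, j, k) is the determinant of columns i, j, k of the 3-row matrix with rows a, b, c.
    _∧_∧_ : Vector → Vector → Vector → Tensor
    (a ∧ b ∧ c) i j k = alt ((a ⊗ b ⊗ c) i j k) ((b ⊗ c ⊗ a) i j k) ((c ⊗ a ⊗ b) i j k)
                            ((a ⊗ c ⊗ b) i j k) ((b ⊗ a ⊗ c) i j k) ((c ⊗ b ⊗ a) i j k)

    ∧-rotate : ∀ a b c i j k → (a ∧ b ∧ c) j k i ≈ (a ∧ b ∧ c) i j k
    ∧-rotate a b c i j k = trans
      (alt-cong (xy∙z≈zx∙y _ _ _) (xy∙z≈zx∙y _ _ _) (xy∙z≈zx∙y _ _ _) (xy∙z≈zx∙y _ _ _) (xy∙z≈zx∙y _ _ _) (xy∙z≈zx∙y _ _ _))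
      (alt-rotate _ _ _ _ _ _)

    ∧-swap₂₃ : ∀ a b c i j k → (a ∧ b ∧ c) i k j ≈ - (a ∧ b ∧ c) i j k
    ∧-swap₂₃ a b c i j k = trans
      (alt-cong (xy∙z≈xz∙y _ _ _) (xy∙z≈xz∙y _ _ _) (xy∙z≈xz∙y _ _ _) (xy∙z≈xz∙y _ _ _) (xy∙z≈xz∙y _ _ _) (xy∙z≈xz∙y _ _ _))
      (alt-swap _ _ _ _ _ _)

    infix 8 ⟨_∣_⟩
    -- Bilinear, without conjugation, so that the trace identity holds in every commutative ring.
    ⟨_∣_⟩ : Vector → Vector → Carrier
    ⟨ u ∣ v ⟩ = ∑ (λ i → u i * v i)

    ⊗-inner : ∀ u v w a b c → ∑³ (λ i j k → (u ⊗ v ⊗ w) i j k * (a ⊗ b ⊗ c) i j k) ≈ ⟨ a ∣ u ⟩ * ⟨ b ∣ v ⟩ * ⟨ c ∣ w ⟩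
    ⊗-inner u v w a b c = trans (∑³-cong (λ i j k → trans (interchange _ _ _ _) (*-cong (trans (interchange _ _ _ _) (*-cong (*-comm _ _) (*-comm _ _))) (*-comm _ _)))) (∑³-product _ _ _)

    module _ (a b c : Vector) where

      pairing : Vector → Vector → Vector → Carrier
      pairing u v w = ∑³ (λ i j k → (u ⊗ v ⊗ w) i j k * (a ∧ b ∧ c) i j k)

      -- Each of the six pure tensors pairs to a product of three inner products, which together
      -- form a 3 × 3 Gram determinant.
      pairing-gram : ∀ u v w → pairing u v w ≈
        alt (⟨ a ∣ u ⟩ * ⟨ b ∣ v ⟩ * ⟨ c ∣ w ⟩) (⟨ b ∣ u ⟩ * ⟨ c ∣ v ⟩ * ⟨ a ∣ w ⟩) (⟨ c ∣ u ⟩ * ⟨ a ∣ v ⟩ * ⟨ b ∣ w ⟩)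
            (⟨ a ∣ u ⟩ * ⟨ c ∣ v ⟩ * ⟨ b ∣ w ⟩) (⟨ b ∣ u ⟩ * ⟨ a ∣ v ⟩ * ⟨ c ∣ w ⟩) (⟨ c ∣ u ⟩ * ⟨ b ∣ v ⟩ * ⟨ a ∣ w ⟩)
      pairing-gram u v w = trans (∑³-cong (λ i j k → *-alt _ _ _ _ _ _ _)) (trans (∑³-alt _ _ _ _ _ _)
        (alt-cong (⊗-inner u v w a b c) (⊗-inner u v w b c a) (⊗-inner u v w c a b)
                  (⊗-inner u v w a c b) (⊗-inner u v w b a c) (⊗-inner u v w c b a)))

      pairing-rotate : ∀ u v w → pairing v w u ≈ pairing u v w
      pairing-rotate u v w = trans
        (∑³-cong (λ i j k → *-cong (xy∙z≈zx∙y (v i) (w j) (u k)) (∧-rotate a b c k i j)))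
        (sym (∑³-rotate (λ i j k → (u ⊗ v ⊗ w) k i j * (a ∧ b ∧ c) k i j)))

      pairing-swap₂₃ : ∀ u v w → pairing u w v ≈ - pairing u v w
      pairing-swap₂₃ u v w = trans
        (sym (∑³-swap₂₃ (λ i j k → (u ⊗ w ⊗ v) i j k * (a ∧ b ∧ c) i j k)))
        (trans (∑³-cong (λ i j k → trans (*-cong (xy∙z≈xz∙y _ _ _) (∧-swap₂₃ a b c i j k)) (sym (-‿distribʳ-* _ _)))) (∑³-neg _))

      -- The first wedge is alternating, so the six pure tensors of the second each contribute `p`
      -- up to sign. The total, 6 p, stays unreduced because it is only ever compared with another
      -- of the same shape.
      ∧-inner : ∀ u v w → let p = pairing u v w in
        ∑³ (λ i j k → (a ∧ b ∧ c) i j k * (u ∧ v ∧ w) i j k) ≈ alt p p p (- p) (- p) (- p)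
      ∧-inner u v w = trans (∑³-cong (λ i j k → *-alt _ _ _ _ _ _ _)) (trans (∑³-alt _ _ _ _ _ _)
        (alt-cong (flip u v w) (trans (flip v w u) (pairing-rotate u v w))
                  (trans (flip w u v) (sym (pairing-rotate w u v)))
                  (trans (flip u w v) (pairing-swap₂₃ u v w))
                  (trans (flip v u w) (trans (sym (pairing-rotate v u w)) (pairing-swap₂₃ u v w)))
                  (trans (flip w v u) (trans (pairing-rotate u w v) (pairing-swap₂₃ u v w)))))
        where
        flip : ∀ x y z → ∑³ (λ i j k → (a ∧ b ∧ c) i j k * (x ⊗ y ⊗ z) i j k) ≈ pairing x y z
        flip x y z = ∑³-cong (λ i j k → *-comm _ _)

    module _ (A : Matrix n) where

      row column : Fin n → Vector
      row x i = A x i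
      column x i = A i x

      Q : Matrix n
      Q x y = ⟨ row x ∣ column y ⟩

      t₁ t₂ t₃ : Carrier
      t₁ = ∑ (λ x → Q x x)
      t₂ = ∑ (λ x → ∑ (λ y → Q x y * Q y x))
      t₃ = ∑³ (λ x y z → Q x y * Q y z * Q z x)

      -- The Gram matrix has entries of Q = A². After summation a permutation contributes according
      -- to its cycle type: the identity t₁³, a 3-cycle t₃, a transposition t₁ t₂.
      ∑³-gram : ∑³ (λ x y z → pairing (row x) (row y) (row z) (column x) (column y) (column z)) ≈
        alt (t₁ * t₁ * t₁) t₃ t₃ (t₁ * t₂) (t₁ * t₂) (t₁ * t₂)
      ∑³-gram = trans (∑³-cong (λ x y z → pairing-gram (row x) (row y) (row z) (column x) (column y) (column z)))
        (trans (∑³-alt _ _ _ _ _ _) (alt-cong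
          (∑³-product _ _ _)
          (trans (sym (∑³-swap₂₃ (λ x y z → Q y x * Q z y * Q x z))) (∑³-cong (λ x y z → xy∙z≈zy∙x (Q z x) (Q y z) (Q x y))))
          (∑³-cong (λ x y z → xy∙z≈yz∙x (Q z x) (Q x y) (Q y z)))
          fixed
          (trans (sym (∑³-rotate (λ x y z → Q y x * Q x y * Q z z))) (trans (∑³-cong (λ x y z → xy∙z≈z∙xy _ _ _)) fixed′))
          (trans (sym (∑³-swap₁₂ (λ x y z → Q z x * Q y y * Q x z))) (trans (∑³-cong (λ x y z → xy∙z≈y∙xz _ _ _)) fixed′))))
        where
        fixed′ : ∑³ (λ x y z → Q x x * (Q z y * Q y z)) ≈ t₁ * t₂
        fixed′ = trans (∑-cong (λ x → trans (∑-cong (λ y → trans (∑-cong (λ z → *-congˡ (*-comm _ _))) (sym (*-∑ _ _)))) (sym (*-∑ _ _)))) (sym (∑-* _ _))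
        fixed : ∑³ (λ x y z → Q x x * Q z y * Q y z) ≈ t₁ * t₂
        fixed = trans (∑³-cong (λ x y z → *-assoc _ _ _)) fixed′

      -- `cominor³` exchanges the row and column indices; for a Hermitian matrix it is the conjugate
      -- of `minor³`.
      minor³ cominor³ : (x y z i j k : Fin n) → Carrier
      minor³ x y z = row x ∧ row y ∧ row z
      cominor³ x y z = column x ∧ column y ∧ column z

      sumOfMinors : Carrier
      sumOfMinors = ∑³ (λ x y z → ∑³ (λ i j k → minor³ x y z i j k * cominor³ x y z i j k))

      minors-traces : let g = alt (t₁ * t₁ * t₁) t₃ t₃ (t₁ * t₂) (t₁ * t₂) (t₁ * t₂) in
        sumOfMinors ≈ alt g g g (- g) (- g) (- g)
      minors-traces = trans (∑³-cong (λ x y z → ∧-inner (row x) (row y) (row z) (column x) (column y) (column z)))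
        (trans (∑³-alt _ _ _ _ _ _) (alt-cong ∑³-gram ∑³-gram ∑³-gram ∑³-gram⁻ ∑³-gram⁻ ∑³-gram⁻))
        where
        ∑³-gram⁻ = trans (∑³-neg _) (-‿cong ∑³-gram)

      pow-+2 : ∀ k x y → pow A (suc (suc k)) x y ≈ ∑ (λ c → Q x c * pow A k c y)
      pow-+2 k x y = begin
        ∑ (λ d → A x d * ∑ (λ c → A d c * pow A k c y))   ≈⟨ ∑-cong (λ d → *-∑ _ _) ⟩
        ∑ (λ d → ∑ (λ c → A x d * (A d c * pow A k c y))) ≈⟨ ∑-swap _ ⟩
        ∑ (λ c → ∑ (λ d → A x d * (A d c * pow A k c y))) ≈⟨ ∑-cong (λ c → trans (∑-cong (λ d → sym (*-assoc _ _ _))) (sym (∑-* _ _))) ⟩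
        ∑ (λ c → Q x c * pow A k c y)                     ∎

      pow-2 : ∀ x y → pow A 2 x y ≈ Q x y
      pow-2 x y = trans (pow-+2 0 x y) (∑-I (Q x) y)

      trace-pow-2 : trace (pow A 2) ≈ t₁
      trace-pow-2 = ∑-cong (λ x → pow-2 x x)

      pow-4 : ∀ x y → pow A 4 x y ≈ ∑ (λ c → Q x c * Q c y)
      pow-4 x y = trans (pow-+2 2 x y) (∑-cong (λ c → *-congˡ (pow-2 c y)))

      trace-pow-4 : trace (pow A 4) ≈ t₂
      trace-pow-4 = ∑-cong (λ x → pow-4 x x)

      trace-pow-6 : trace (pow A 6) ≈ t₃
      trace-pow-6 = ∑-cong (λ x → trans (pow-+2 4 x x) (∑-cong (λ y →
        trans (*-congˡ (pow-4 y x)) (trans (*-∑ _ _) (∑-cong (λ z → sym (*-assoc _ _ _)))))))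

  det₂ : (M : Matrix 2) → det M ≈ M zero zero * M (suc zero) (suc zero) + - (M zero (suc zero) * M (suc zero) zero)
  det₂ M = +-cong (*-congˡ (det₁ _)) (trans (+-identityʳ _) (-‿cong (*-congˡ (det₁ _))))
    where
    det₁ : (a : Carrier) → a * 1# + 0# ≈ a
    det₁ a = trans (+-identityʳ _) (*-identityʳ _)

  det₃ : ∀ {n} (A : Matrix n) (f g : Fin 3 → Fin n) →
    det (λ a b → A (f a) (g b)) ≈ minor³ A (f zero) (f (suc zero)) (f (suc (suc zero))) (g zero) (g (suc zero)) (g (suc (suc zero)))
  det₃ A f g = begin
    a i * _ + (- (a j * _) + (a k * _ + 0#))
      ≈⟨ +-cong (*-congˡ (det₂ (minor₀ M zero))) (+-cong (-‿cong (*-congˡ (det₂ (minor₀ M (suc zero)))))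
           (trans (+-identityʳ _) (*-congˡ (det₂ (minor₀ M (suc (suc zero))))))) ⟩
    a i * (b j * c k + - (b k * c j)) + (- (a j * (b i * c k + - (b k * c i))) + a k * (b i * c j + - (b j * c i)))
      ≈⟨ +-cong (expand _ _ _) (+-cong (trans (-‿cong (expand _ _ _)) (sym (-‿+-comm _ _))) (expand _ _ _)) ⟩
    (a i * (b j * c k) + - (a i * (b k * c j))) + ((- (a j * (b i * c k)) + - - (a j * (b k * c i))) + (a k * (b i * c j) + - (a k * (b j * c i))))
      ≈⟨ +-congˡ (+-congʳ (+-congˡ (-‿involutive _))) ⟩
    (a i * (b j * c k) + - (a i * (b k * c j))) + ((- (a j * (b i * c k)) + a j * (b k * c i)) + (a k * (b i * c j) + - (a k * (b j * c i))))
      ≈⟨ solve 6 (λ p q r s t w → ((p ⊕ q) ⊕ ((r ⊕ s) ⊕ (t ⊕ w))) ⊜ (((p ⊕ t) ⊕ s) ⊕ ((q ⊕ r) ⊕ w))) refl _ _ _ _ _ _ ⟩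
    (a i * (b j * c k) + a k * (b i * c j) + a j * (b k * c i)) + (- (a i * (b k * c j)) + - (a j * (b i * c k)) + - (a k * (b j * c i)))
      ≈⟨ +-congˡ (trans (+-congʳ (-‿+-comm _ _)) (-‿+-comm _ _)) ⟩
    alt (a i * (b j * c k)) (a k * (b i * c j)) (a j * (b k * c i)) (a i * (b k * c j)) (a j * (b i * c k)) (a k * (b j * c i))
      ≈⟨ alt-cong (sym (*-assoc _ _ _)) (x∙yz≈yz∙x _ _ _) (x∙yz≈zx∙y _ _ _) (x∙yz≈xz∙y _ _ _) (x∙yz≈yx∙z _ _ _) (x∙yz≈zy∙x _ _ _) ⟩
    minor³ A (f zero) (f (suc zero)) (f (suc (suc zero))) i j k ∎
    where
    M : Matrix 3
    M a b = A (f a) (g b)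
    i = g zero
    j = g (suc zero)
    k = g (suc (suc zero))
    a = A (f zero)
    b = A (f (suc zero))
    c = A (f (suc (suc zero)))
    expand : ∀ x y z → x * (y + - z) ≈ x * y + - (x * z)
    expand x y z = trans (distribˡ _ _ _) (+-congˡ (sym (-‿distribʳ-* _ _)))

-- Hermitian matrices: from the sum back to the single minors.

module PositiveMinors (R : CommutativeRing 0ℓ 0ℓ)
  (conj : CommutativeRing.Carrier R → CommutativeRing.Carrier R) (NonNegative : CommutativeRing.Carrier R → Set) where

  open CommutativeRing R hiding (zero)
  open Determinant R
  open ThreeMinors R

  record IsPositive : Set where
    field
      conj-+   : ∀ x y → conj (x + y) ≈ conj x + conj y
      conj-neg : ∀ x → conj (- x) ≈ - conj x
      conj-*   : ∀ x y → conj (x * y) ≈ conj x * conj y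
      resp     : ∀ {x y} → x ≈ y → NonNegative x → NonNegative y
      ∑-nonNegative : ∀ {n} (f : Fin n → Carrier) → (∀ i → NonNegative (f i)) → NonNegative (∑ f)
      ∑-zero⁻¹ : ∀ {n} (f : Fin n → Carrier) → (∀ i → NonNegative (f i)) → ∑ f ≈ 0# → ∀ i → f i ≈ 0#
      norm-nonNegative : ∀ z → NonNegative (z * conj z)
      norm-zero : ∀ z → z * conj z ≈ 0# → z ≈ 0#

  Hermitian : ∀ {n} → Matrix n → Set
  Hermitian A = ∀ x y → A y x ≈ conj (A x y)

  minors-zero⇒sum-zero : ∀ {n} (A : Matrix n) → (∀ x y z i j k → minor³ A x y z i j k ≈ 0#) → sumOfMinors A ≈ 0#
  minors-zero⇒sum-zero A zeros = ∑-zero λ x → ∑-zero λ y → ∑-zero λ z → ∑-zero λ i → ∑-zero λ j → ∑-zero λ k →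
    trans (*-congʳ (zeros x y z i j k)) (zeroˡ _)

  module _ (positive : IsPositive) where

    open IsPositive positive

    ∑³-nonNegative : ∀ {n} (f : Tensor {n}) → (∀ i j k → NonNegative (f i j k)) → NonNegative (∑³ f)
    ∑³-nonNegative f nn = ∑-nonNegative _ (λ i → ∑-nonNegative _ (λ j → ∑-nonNegative _ (nn i j)))

    ∑³-zero⁻¹ : ∀ {n} (f : Tensor {n}) → (∀ i j k → NonNegative (f i j k)) → ∑³ f ≈ 0# → ∀ i j k → f i j k ≈ 0#
    ∑³-zero⁻¹ f nn eq i j = ∑-zero⁻¹ _ (nn i j)
      (∑-zero⁻¹ _ (λ j → ∑-nonNegative _ (nn i j)) (∑-zero⁻¹ _ (λ i → ∑-nonNegative _ (λ j → ∑-nonNegative _ (nn i j))) eq i) j)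

    conj-alt : ∀ e₁ e₂ e₃ o₁ o₂ o₃ →
      conj (alt e₁ e₂ e₃ o₁ o₂ o₃) ≈ alt (conj e₁) (conj e₂) (conj e₃) (conj o₁) (conj o₂) (conj o₃)
    conj-alt e₁ e₂ e₃ o₁ o₂ o₃ = trans (conj-+ _ _)
      (+-cong (sum₃ e₁ e₂ e₃) (trans (conj-neg _) (-‿cong (sum₃ o₁ o₂ o₃))))
      where
      sum₃ : ∀ x y z → conj (x + y + z) ≈ conj x + conj y + conj z
      sum₃ x y z = trans (conj-+ _ _) (+-congʳ (conj-+ _ _))

    conj-⊗ : ∀ {n} {a b c a′ b′ c′ : Vector {n}} → (∀ i → a′ i ≈ conj (a i)) → (∀ i → b′ i ≈ conj (b i)) → (∀ i → c′ i ≈ conj (c i)) →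
      ∀ i j k → conj ((a ⊗ b ⊗ c) i j k) ≈ (a′ ⊗ b′ ⊗ c′) i j k
    conj-⊗ ha hb hc i j k = trans (conj-* _ _)
      (*-cong (trans (conj-* _ _) (*-cong (sym (ha i)) (sym (hb j)))) (sym (hc k)))

    cominor-conj : ∀ {n} {A : Matrix n} → Hermitian A → ∀ x y z i j k → conj (minor³ A x y z i j k) ≈ cominor³ A x y z i j k
    cominor-conj herm x y z i j k = trans (conj-alt _ _ _ _ _ _)
      (alt-cong (conj-⊗ ha hb hc i j k) (conj-⊗ hb hc ha i j k) (conj-⊗ hc ha hb i j k)
                (conj-⊗ ha hc hb i j k) (conj-⊗ hb ha hc i j k) (conj-⊗ hc hb ha i j k))
      where
      ha = herm x
      hb = herm y
      hc = herm z

    -- Every summand is a minor times its own conjugate, hence nonnegative, and the norm is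
    -- definite.
    sum-zero⇒minors-zero : ∀ {n} {A : Matrix n} → Hermitian A → sumOfMinors A ≈ 0# → ∀ x y z i j k → minor³ A x y z i j k ≈ 0#
    sum-zero⇒minors-zero {A = A} herm eq x y z i j k = norm-zero _
      (trans (*-congˡ (cominor-conj herm x y z i j k))
        (∑³-zero⁻¹ _ (nn x y z) (∑³-zero⁻¹ _ (λ x y z → ∑³-nonNegative _ (nn x y z)) eq x y z) i j k))
      where
      nn : ∀ x y z i j k → NonNegative (minor³ A x y z i j k * cominor³ A x y z i j k)
      nn x y z i j k = resp (*-congˡ (cominor-conj herm x y z i j k)) (norm-nonNegative _)

    -- The sum depends only on the traces of the second, fourth and sixth powers, which agree. It
    -- vanishes termwise for `A`, and positivity separates the terms again for `A′`.
    minors-zero-transfer : ∀ {n} {A A′ : Matrix n} → Hermitian A′ → (∀ k → trace (pow A k) ≈ trace (pow A′ k)) →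
      (∀ x y z i j k → minor³ A x y z i j k ≈ 0#) → ∀ x y z i j k → minor³ A′ x y z i j k ≈ 0#
    minors-zero-transfer {A = A} {A′} herm traces zeros = sum-zero⇒minors-zero herm
      (trans (minors-traces A′) (trans (alt-cong g g g (-‿cong g) (-‿cong g) (-‿cong g))
        (trans (sym (minors-traces A)) (minors-zero⇒sum-zero A zeros))))
      where
      h₁ : t₁ A′ ≈ t₁ A
      h₁ = trans (sym (trace-pow-2 A′)) (trans (sym (traces 2)) (trace-pow-2 A))
      h₂ : t₂ A′ ≈ t₂ A
      h₂ = trans (sym (trace-pow-4 A′)) (trans (sym (traces 4)) (trace-pow-4 A))
      h₃ : t₃ A′ ≈ t₃ A
      h₃ = trans (sym (trace-pow-6 A′)) (trans (sym (traces 6)) (trace-pow-6 A))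
      g = alt-cong (*-cong (*-cong h₁ h₁) h₁) h₃ h₃ (*-cong h₁ h₂) (*-cong h₁ h₂) (*-cong h₁ h₂)

-- The Eisenstein integers, their conjugation and norm.

re-assoc : ∀ a b c d e f → (a ℤ.* c ℤ.- b ℤ.* d) ℤ.* e ℤ.- (a ℤ.* d ℤ.+ b ℤ.* c ℤ.+ b ℤ.* d) ℤ.* f ≡
  a ℤ.* (c ℤ.* e ℤ.- d ℤ.* f) ℤ.- b ℤ.* (c ℤ.* f ℤ.+ d ℤ.* e ℤ.+ d ℤ.* f)
re-assoc = solve-∀

im-assoc : ∀ a b c d e f →
  (a ℤ.* c ℤ.- b ℤ.* d) ℤ.* f ℤ.+ (a ℤ.* d ℤ.+ b ℤ.* c ℤ.+ b ℤ.* d) ℤ.* e ℤ.+ (a ℤ.* d ℤ.+ b ℤ.* c ℤ.+ b ℤ.* d) ℤ.* f ≡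
  a ℤ.* (c ℤ.* f ℤ.+ d ℤ.* e ℤ.+ d ℤ.* f) ℤ.+ b ℤ.* (c ℤ.* e ℤ.- d ℤ.* f) ℤ.+ b ℤ.* (c ℤ.* f ℤ.+ d ℤ.* e ℤ.+ d ℤ.* f)
im-assoc = solve-∀

im-comm : ∀ a b c d → a ℤ.* d ℤ.+ b ℤ.* c ℤ.+ b ℤ.* d ≡ c ℤ.* b ℤ.+ d ℤ.* a ℤ.+ d ℤ.* b
im-comm = solve-∀

re-distrib : ∀ a b c d e f → a ℤ.* (c ℤ.+ e) ℤ.- b ℤ.* (d ℤ.+ f) ≡ (a ℤ.* c ℤ.- b ℤ.* d) ℤ.+ (a ℤ.* e ℤ.- b ℤ.* f)
re-distrib = solve-∀

im-distrib : ∀ a b c d e f → a ℤ.* (d ℤ.+ f) ℤ.+ b ℤ.* (c ℤ.+ e) ℤ.+ b ℤ.* (d ℤ.+ f) ≡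
  (a ℤ.* d ℤ.+ b ℤ.* c ℤ.+ b ℤ.* d) ℤ.+ (a ℤ.* f ℤ.+ b ℤ.* e ℤ.+ b ℤ.* f)
im-distrib = solve-∀

re-identity : ∀ a b → + 1 ℤ.* a ℤ.- + 0 ℤ.* b ≡ a
re-identity = solve-∀

im-identity : ∀ a b → + 1 ℤ.* b ℤ.+ + 0 ℤ.* a ℤ.+ + 0 ℤ.* b ≡ b
im-identity = solve-∀

*ω-comm : ∀ x y → x *ω y ≡ y *ω x
*ω-comm ⟨ a , b ⟩ ⟨ c , d ⟩ = ≡.cong₂ ⟨_,_⟩ (≡.cong₂ ℤ._-_ (ℤₚ.*-comm a c) (ℤₚ.*-comm b d)) (im-comm a b c d)

*ω-distribˡ : ∀ x y z → x *ω (y +ω z) ≡ (x *ω y) +ω (x *ω z)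
*ω-distribˡ ⟨ a , b ⟩ ⟨ c , d ⟩ ⟨ e , f ⟩ = ≡.cong₂ ⟨_,_⟩ (re-distrib a b c d e f) (im-distrib a b c d e f)

*ω-identityˡ : ∀ x → 1ω *ω x ≡ x
*ω-identityˡ ⟨ a , b ⟩ = ≡.cong₂ ⟨_,_⟩ (re-identity a b) (im-identity a b)

eisenstein : CommutativeRing 0ℓ 0ℓ
eisenstein = record
  { Carrier = ℤω
  ; _≈_ = _≡_
  ; _+_ = _+ω_
  ; _*_ = _*ω_
  ; -_ = -ω_
  ; 0# = 0ω
  ; 1# = 1ω
  ; isCommutativeRing = record
    { isRing = record
      { +-isAbelianGroup = record
        { isGroup = record
          { isMonoid = record
            { isSemigroup = record
              { isMagma = record { isEquivalence = ≡.isEquivalence ; ∙-cong = ≡.cong₂ _+ω_ }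
              ; assoc = λ x y z → ≡.cong₂ ⟨_,_⟩ (ℤₚ.+-assoc (re x) (re y) (re z)) (ℤₚ.+-assoc (im x) (im y) (im z))
              }
            ; identity = (λ x → ≡.cong₂ ⟨_,_⟩ (ℤₚ.+-identityˡ (re x)) (ℤₚ.+-identityˡ (im x)))
                       , (λ x → ≡.cong₂ ⟨_,_⟩ (ℤₚ.+-identityʳ (re x)) (ℤₚ.+-identityʳ (im x)))
            }
          ; inverse = (λ x → ≡.cong₂ ⟨_,_⟩ (ℤₚ.+-inverseˡ (re x)) (ℤₚ.+-inverseˡ (im x)))
                    , (λ x → ≡.cong₂ ⟨_,_⟩ (ℤₚ.+-inverseʳ (re x)) (ℤₚ.+-inverseʳ (im x)))
          ; ⁻¹-cong = ≡.cong -ω_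
          }
        ; comm = λ x y → ≡.cong₂ ⟨_,_⟩ (ℤₚ.+-comm (re x) (re y)) (ℤₚ.+-comm (im x) (im y))
        }
      ; *-cong = ≡.cong₂ _*ω_
      ; *-assoc = λ x y z → ≡.cong₂ ⟨_,_⟩ (re-assoc (re x) (im x) (re y) (im y) (re z) (im z))
                                          (im-assoc (re x) (im x) (re y) (im y) (re z) (im z))
      ; *-identity = *ω-identityˡ , λ x → ≡.trans (*ω-comm x 1ω) (*ω-identityˡ x)
      ; distrib = *ω-distribˡ , λ x y z → ≡.trans (*ω-comm (y +ω z) x)
                    (≡.trans (*ω-distribˡ x y z) (≡.cong₂ _+ω_ (*ω-comm x y) (*ω-comm x z)))
      }
    ; *-comm = *ω-comm
    }
  }

-- From ω̄ = 1 - ω: the conjugate of a + b ω is (a + b) - b ω.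
conj : ℤω → ℤω
conj ⟨ a , b ⟩ = ⟨ a ℤ.+ b , ℤ.- b ⟩

conj-+ : ∀ x y → conj (x +ω y) ≡ conj x +ω conj y
conj-+ ⟨ a , b ⟩ ⟨ c , d ⟩ = ≡.cong₂ ⟨_,_⟩ (real a b c d) (ℤₚ.neg-distrib-+ b d)
  where
  real : ∀ a b c d → a ℤ.+ c ℤ.+ (b ℤ.+ d) ≡ a ℤ.+ b ℤ.+ (c ℤ.+ d)
  real = solve-∀

conj-neg : ∀ x → conj (-ω x) ≡ -ω conj x
conj-neg ⟨ a , b ⟩ = ≡.cong ⟨_, ℤ.- (ℤ.- b) ⟩ (≡.sym (ℤₚ.neg-distrib-+ a b))

conj-* : ∀ x y → conj (x *ω y) ≡ conj x *ω conj y
conj-* ⟨ a , b ⟩ ⟨ c , d ⟩ = ≡.cong₂ ⟨_,_⟩ (real a b c d) (imag a b c d)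
  where
  real : ∀ a b c d → (a ℤ.* c ℤ.- b ℤ.* d) ℤ.+ (a ℤ.* d ℤ.+ b ℤ.* c ℤ.+ b ℤ.* d) ≡
    (a ℤ.+ b) ℤ.* (c ℤ.+ d) ℤ.- ℤ.- b ℤ.* ℤ.- d
  real = solve-∀
  imag : ∀ a b c d → ℤ.- (a ℤ.* d ℤ.+ b ℤ.* c ℤ.+ b ℤ.* d) ≡
    (a ℤ.+ b) ℤ.* ℤ.- d ℤ.+ ℤ.- b ℤ.* (c ℤ.+ d) ℤ.+ ℤ.- b ℤ.* ℤ.- d
  imag = solve-∀

record NonNegative (z : ℤω) : Set where
  constructor _,_
  field
    real : im z ≡ + 0
    sign : + 0 ℤ.≤ re z

square-nonNegative : ∀ a → + 0 ℤ.≤ a ℤ.* a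
square-nonNegative (+ zero)  = ℤ.+≤+ ℕ.z≤n
square-nonNegative (+ suc n) = ℤ.+≤+ ℕ.z≤n
square-nonNegative -[1+ n ]  = ℤ.+≤+ ℕ.z≤n

square-zero : ∀ a → a ℤ.* a ≡ + 0 → a ≡ + 0
square-zero a eq with ℤₚ.i*j≡0⇒i≡0∨j≡0 a eq
... | inj₁ a≡0 = a≡0
... | inj₂ a≡0 = a≡0

sum-zero : ∀ {a b} → + 0 ℤ.≤ a → + 0 ℤ.≤ b → a ℤ.+ b ≡ + 0 → a ≡ + 0 × b ≡ + 0
sum-zero {+ zero} {+ zero} _ _ _ = ≡.refl , ≡.refl
sum-zero {+ zero} {+ suc n} _ _ ()
sum-zero {+ suc m} {+ n} _ _ ()

norm : ∀ a b → ⟨ a , b ⟩ *ω conj ⟨ a , b ⟩ ≡ ⟨ a ℤ.* a ℤ.+ a ℤ.* b ℤ.+ b ℤ.* b , + 0 ⟩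
norm a b = ≡.cong₂ ⟨_,_⟩ (real a b) (imag a b)
  where
  real : ∀ a b → a ℤ.* (a ℤ.+ b) ℤ.- b ℤ.* ℤ.- b ≡ a ℤ.* a ℤ.+ a ℤ.* b ℤ.+ b ℤ.* b
  real = solve-∀
  imag : ∀ a b → a ℤ.* ℤ.- b ℤ.+ b ℤ.* (a ℤ.+ b) ℤ.+ b ℤ.* ℤ.- b ≡ + 0
  imag = solve-∀

-- Completing the square; the factor 4 keeps it integral. Both nonnegativity and definiteness of the
-- norm are read off from this form.
fourNorm : ∀ a b → + 4 ℤ.* (a ℤ.* a ℤ.+ a ℤ.* b ℤ.+ b ℤ.* b) ≡ (a ℤ.+ a ℤ.+ b) ℤ.* (a ℤ.+ a ℤ.+ b) ℤ.+ + 3 ℤ.* (b ℤ.* b)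
fourNorm = solve-∀

three-squares-nonNegative : ∀ b → + 0 ℤ.≤ + 3 ℤ.* (b ℤ.* b)
three-squares-nonNegative b = ℤₚ.*-monoˡ-≤-nonNeg (+ 3) (square-nonNegative b)

three-squares-zero : ∀ b → + 3 ℤ.* (b ℤ.* b) ≡ + 0 → b ≡ + 0
three-squares-zero b eq with ℤₚ.i*j≡0⇒i≡0∨j≡0 (+ 3) eq
... | inj₂ b²≡0 = square-zero b b²≡0

norm-nonNegative : ∀ z → NonNegative (z *ω conj z)
norm-nonNegative ⟨ a , b ⟩ rewrite norm a b = ≡.refl , ℤₚ.*-cancelˡ-≤-pos (+ 0) (a ℤ.* a ℤ.+ a ℤ.* b ℤ.+ b ℤ.* b) (+ 4)
  (≡.subst (+ 0 ℤ.≤_) (≡.sym (fourNorm a b)) (ℤₚ.+-mono-≤ (square-nonNegative (a ℤ.+ a ℤ.+ b)) (three-squares-nonNegative b)))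

norm-zero : ∀ z → z *ω conj z ≡ 0ω → z ≡ 0ω
norm-zero ⟨ a , b ⟩ eq = ≡.cong₂ ⟨_,_⟩ a≡0 b≡0
  where
  squares : (a ℤ.+ a ℤ.+ b) ℤ.* (a ℤ.+ a ℤ.+ b) ℤ.+ + 3 ℤ.* (b ℤ.* b) ≡ + 0
  squares = ≡.trans (≡.sym (fourNorm a b)) (≡.cong (+ 4 ℤ.*_) (≡.cong re (≡.trans (≡.sym (norm a b)) eq)))
  b≡0 : b ≡ + 0
  b≡0 = three-squares-zero b (proj₂ (sum-zero (square-nonNegative (a ℤ.+ a ℤ.+ b)) (three-squares-nonNegative b) squares))
  a≡0 : a ≡ + 0
  a≡0 = square-zero a (≡.trans (≡.sym (≡.trans (≡.cong (λ t → a ℤ.* a ℤ.+ a ℤ.* t ℤ.+ t ℤ.* t) b≡0) (at-zero a)))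
          (≡.cong re (≡.trans (≡.sym (norm a b)) eq)))
    where
    at-zero : ∀ a → a ℤ.* a ℤ.+ a ℤ.* + 0 ℤ.+ + 0 ℤ.* + 0 ≡ a ℤ.* a
    at-zero = solve-∀

open ThreeMinors eisenstein
open Determinant eisenstein

∑-nonNegative : ∀ {n} (f : Fin n → ℤω) → (∀ i → NonNegative (f i)) → NonNegative (∑ f)
∑-nonNegative {zero}  f nn rewrite ∑-empty f = ≡.refl , ℤ.+≤+ ℕ.z≤n
∑-nonNegative {suc n} f nn rewrite ∑-suc f with nn zero | ∑-nonNegative (f ∘ suc) (nn ∘ suc)
... | (r , s) | (r′ , s′) = ≡.cong₂ ℤ._+_ r r′ , ℤₚ.+-mono-≤ s s′

∑-zero⁻¹ : ∀ {n} (f : Fin n → ℤω) → (∀ i → NonNegative (f i)) → ∑ f ≡ 0ω → ∀ i → f i ≡ 0ω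
∑-zero⁻¹ {suc n} f nn eq i = go i
  where
  nn′ = ∑-nonNegative (f ∘ suc) (nn ∘ suc)
  parts = sum-zero (NonNegative.sign (nn zero)) (NonNegative.sign nn′) (≡.cong re (≡.trans (≡.sym (∑-suc f)) eq))
  go : ∀ i → f i ≡ 0ω
  go zero    = ≡.cong₂ ⟨_,_⟩ (proj₁ parts) (NonNegative.real (nn zero))
  go (suc i) = ∑-zero⁻¹ (f ∘ suc) (nn ∘ suc) (≡.cong₂ ⟨_,_⟩ (proj₂ parts) (NonNegative.real nn′)) i

open PositiveMinors eisenstein conj NonNegative using (IsPositive; Hermitian; minors-zero-transfer)

positive : IsPositive
positive = record
  { conj-+ = conj-+
  ; conj-neg = conj-neg
  ; conj-* = conj-*
  ; resp = λ { ≡.refl nn → nn }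
  ; ∑-nonNegative = ∑-nonNegative
  ; ∑-zero⁻¹ = ∑-zero⁻¹
  ; norm-nonNegative = norm-nonNegative
  ; norm-zero = norm-zero
  }

-- Characteristic polynomials of mixed graphs.

open PowerSeries eisenstein 1p ≡.refl (λ _ → ≡.refl) using (Characteristic; powerSums-determined; sizes-equal)

-- The matrix inside `charPoly`, named so that the Newton machinery applies to it directly.
charMatrix : ∀ {n} → MixedGraph n → Fin n → Fin n → Poly
charMatrix M i j = (if ⌊ i ≟ᶠ j ⌋ then X else 0p) +p (-p constP (N M i j))

characteristic : ∀ {n} (M : MixedGraph n) → Characteristic (N M) (charMatrix M)
characteristic M = record { constant = constant ; leading = leading ; linear = linear }
  where
  constant : ∀ i j → charMatrix M i j 0 ≡ -ω N M i j
  constant i j with i ≟ᶠ j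
  ... | yes _ = CommutativeRing.+-identityˡ eisenstein (-ω N M i j)
  ... | no _  = CommutativeRing.+-identityˡ eisenstein (-ω N M i j)
  leading : ∀ i j → charMatrix M i j 1 ≡ I i j
  leading i j with i ≟ᶠ j
  ... | yes ≡.refl = ≡.sym (I-refl i)
  ... | no i≢j     = ≡.sym (I-≢ i j i≢j)
  linear : ∀ i j k → charMatrix M i j (suc (suc k)) ≡ 0ω
  linear i j k with i ≟ᶠ j
  ... | yes _ = ≡.refl
  ... | no _  = ≡.refl

cospectral⇒size : ∀ {n m} {M : MixedGraph n} {M′ : MixedGraph m} → Cospectral M M′ → n ≡ m
cospectral⇒size {M = M} {M′} = sizes-equal (λ ()) (characteristic M) (characteristic M′)

cospectral⇒traces : ∀ {n} {M M′ : MixedGraph n} → Cospectral M M′ → ∀ k → trace (pow (N M) k) ≡ trace (pow (N M′) k)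
cospectral⇒traces {M = M} {M′} = powerSums-determined (characteristic M) (characteristic M′)

N-hermitian : ∀ {n} (M : MixedGraph n) → Hermitian (N M)
N-hermitian M x y rewrite MixedGraph.sym M x y with adj M x y
... | none = ≡.refl
... | und  = ≡.refl
... | arc  = ≡.refl
... | rev  = ≡.refl


-- Finite checks on edges and phases.

infix 4 _≟ᵉ_ _≟ω_

encode : Edge → ℕ
encode none = 0
encode und  = 1
encode arc  = 2
encode rev  = 3

decode : ℕ → Edge
decode 0 = none
decode 1 = und
decode 2 = arc
decode _ = rev

decode-encode : ∀ e → decode (encode e) ≡ e
decode-encode none = ≡.refl
decode-encode und  = ≡.refl
decode-encode arc  = ≡.refl
decode-encode rev  = ≡.refl

_≟ᵉ_ : (e f : Edge) → Dec (e ≡ f)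
e ≟ᵉ f = map′ (λ eq → ≡.trans (≡.sym (decode-encode e)) (≡.trans (≡.cong decode eq) (decode-encode f)))
              (≡.cong encode) (encode e ℕₚ.≟ encode f)

_≟ω_ : (x y : ℤω) → Dec (x ≡ y)
⟨ a , b ⟩ ≟ω ⟨ c , d ⟩ = map′ (λ (p , q) → ≡.cong₂ ⟨_,_⟩ p q) (λ eq → ≡.cong re eq , ≡.cong im eq)
  ((a ℤₚ.≟ c) ×-dec (b ℤₚ.≟ d))

allEdges? : ∀ {P : Edge → Set} → (∀ e → Dec (P e)) → Dec (∀ e → P e)
allEdges? {P} P? = map′ to (λ h → h none , h und , h arc , h rev) (P? none ×-dec P? und ×-dec P? arc ×-dec P? rev)
  where
  to : P none × P und × P arc × P rev → ∀ e → P e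
  to (n , u , a , r) none = n
  to (n , u , a , r) und  = u
  to (n , u , a , r) arc  = a
  to (n , u , a , r) rev  = r

-- entryN e = ω ^ exponent e for e ≢ none; the value at none is junk.
exponent : Edge → ℕ
exponent none = 0
exponent und  = 0
exponent arc  = 1
exponent rev  = 5

-- The minor of N M with rows u, v, x and columns u, v, y, where e, p, q, r, s, t are the edges
-- uv, xu, xv, uy, vy, xy.
edgeMinor : (e p q r s t : Edge) → ℤω
edgeMinor e p q r s t = alt
  ((0ω *ω 0ω) *ω entryN t) ((entryN (flipE e) *ω entryN q) *ω entryN r) ((entryN p *ω entryN e) *ω entryN s)
  ((0ω *ω entryN q) *ω entryN s) ((entryN (flipE e) *ω entryN e) *ω entryN t) ((entryN p *ω 0ω) *ω entryN r)

-- At y = x the minor is the product of the entries around the triangle plus its conjugate. For a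
-- sixth root of unity this is ±1 or ±2, never 0.
triangle : ∀ e p q → e ≢ none → edgeMinor e p q (flipE p) (flipE q) none ≡ 0ω → p ≡ none ⊎ q ≡ none
triangle = toWitness {a? = allEdges? λ e → allEdges? λ p → allEdges? λ q →
  ¬? (e ≟ᵉ none) →-dec ((edgeMinor e p q (flipE p) (flipE q) none ≟ω 0ω) →-dec ((p ≟ᵉ none) ⊎-dec (q ≟ᵉ none)))} _

-- If x is adjacent to neither u nor v, both triple products vanish and the minor is -N_xy.
isolated : ∀ e r s t → e ≢ none → edgeMinor e none none r s t ≡ 0ω → t ≡ none
isolated = toWitness {a? = allEdges? λ e → allEdges? λ r → allEdges? λ s → allEdges? λ t →
  ¬? (e ≟ᵉ none) →-dec ((edgeMinor e none none r s t ≟ω 0ω) →-dec (t ≟ᵉ none))} _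

-- The absent edges xu and uy remove one triple product each, leaving -N_xy; in `same-u` the absent
-- edges are xv and vy.
same-v : ∀ e q s t → e ≢ none → edgeMinor e none q none s t ≡ 0ω → t ≡ none
same-v = toWitness {a? = allEdges? λ e → allEdges? λ q → allEdges? λ s → allEdges? λ t →
  ¬? (e ≟ᵉ none) →-dec ((edgeMinor e none q none s t ≟ω 0ω) →-dec (t ≟ᵉ none))} _

same-u : ∀ e p r t → e ≢ none → edgeMinor e p none r none t ≡ 0ω → t ≡ none
same-u = toWitness {a? = allEdges? λ e → allEdges? λ p → allEdges? λ r → allEdges? λ t →
  ¬? (e ≟ᵉ none) →-dec ((edgeMinor e p none r none t ≟ω 0ω) →-dec (t ≟ᵉ none))} _

-- entryN e = ω ^ (k − j)
Phase : T6 → Edge → T6 → Set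
Phase j e k = e ≢ none × k ≡ j ⊕6 exponent e

phase? : ∀ j e k → Dec (Phase j e k)
phase? j e k = ¬? (e ≟ᵉ none) ×-dec (k ≟ᶠ (j ⊕6 exponent e))

-- Phases are measured from v: a neighbour x of v takes the exponent of the edge vx, a neighbour y
-- of u that of the path v, u, y.
phaseᵛ : Edge → T6
phaseᵛ q = zero ⊕6 exponent q

phaseᵘ : Edge → Edge → T6
phaseᵘ e r = (zero ⊕6 exponent (flipE e)) ⊕6 exponent r

-- Only N_xv N_vu N_uy survives, so N_xy is the product of the entries along the path x, v, u, y,
-- and exponents add.
crossing : ∀ e q r t → e ≢ none → q ≢ none → r ≢ none → edgeMinor e none q r none t ≡ 0ω →
  Phase (phaseᵛ (flipE q)) t (phaseᵘ e r)
crossing = toWitness {a? = allEdges? λ e → allEdges? λ q → allEdges? λ r → allEdges? λ t →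
  ¬? (e ≟ᵉ none) →-dec (¬? (q ≟ᵉ none) →-dec (¬? (r ≟ᵉ none) →-dec ((edgeMinor e none q r none t ≟ω 0ω) →-dec
    phase? (phaseᵛ (flipE q)) t (phaseᵘ e r))))} _

phase-flip : ∀ e j k → Phase j e k → Phase k (flipE e) j
phase-flip = toWitness {a? = allEdges? λ e → all? λ j → all? λ k → phase? j e k →-dec phase? k (flipE e) j} _

_⊖6_ : T6 → T6 → T6
j ⊖6 k = j ⊕6 (6 ∸ toℕ k)

Switches : (j k : T6) → Edge → Edge → Set
Switches j k e f = (f ≡ switchEntry j k e)
  × (e ≡ und → (k ≡ j) ⊎ (k ≡ j ⊕6 1) ⊎ (j ≡ k ⊕6 1))
  × (e ≡ arc → (k ≡ j) ⊎ (k ≡ j ⊕6 5) ⊎ (k ≡ j ⊕6 4))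

switches? : ∀ j k e f → Dec (Switches j k e f)
switches? j k e f = (f ≟ᵉ switchEntry j k e)
  ×-dec ((e ≟ᵉ und) →-dec ((k ≟ᶠ j) ⊎-dec ((k ≟ᶠ (j ⊕6 1)) ⊎-dec (j ≟ᶠ (k ⊕6 1)))))
  ×-dec ((e ≟ᵉ arc) →-dec ((k ≟ᶠ j) ⊎-dec ((k ≟ᶠ (j ⊕6 5)) ⊎-dec (k ≟ᶠ (j ⊕6 4)))))

-- The classes of the two ends differ by the change of exponent, which lies in {0, ±1, ±2}: ±1 at an
-- undirected edge, -1 or -2 along an arc. The phases at the second end are determined by those at
-- the first, so `j` and `l` are the only ones to run over.
switches-explicit : ∀ e f → e ≢ none → f ≢ none → ∀ j l →
  Switches (l ⊖6 j) ((l ⊕6 exponent f) ⊖6 (j ⊕6 exponent e)) e f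
switches-explicit = toWitness {a? = allEdges? λ e → allEdges? λ f →
  ¬? (e ≟ᵉ none) →-dec (¬? (f ≟ᵉ none) →-dec (all? λ j → all? λ l →
    switches? (l ⊖6 j) ((l ⊕6 exponent f) ⊖6 (j ⊕6 exponent e)) e f))} _

switches : ∀ e f j k l m → Phase j e k → Phase l f m → Switches (l ⊖6 j) (m ⊖6 k) e f
switches e f j _ l _ (e≢none , ≡.refl) (f≢none , ≡.refl) = switches-explicit e f e≢none f≢none j l

-- Connected graphs with vanishing 3 × 3 minors are complete bipartite with a phase function.

-- `Phase` contains the existence of the edge, so `cross` also says that the bipartite graph is
-- complete.
record Bipartition {n} (M : MixedGraph n) : Set where
  field
    colour : Fin n → Bool
    phase  : Fin n → T6
    same   : ∀ x y → colour x ≡ colour y → adj M x y ≡ none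
    cross  : ∀ x y → colour x ≢ colour y → Phase (phase x) (adj M x y) (phase y)

module Structure {n} (M : MixedGraph n) (connected : Connected M)
  (minors : ∀ x y z i j k → minor³ (N M) x y z i j k ≡ 0ω) (u v : Fin n) (u~v : adj M u v ≢ none) where

  vanish : ∀ x y → edgeMinor (adj M u v) (adj M x u) (adj M x v) (adj M u y) (adj M v y) (adj M x y) ≡ 0ω
  vanish x y = simplify (adj M u v) (adj M x u) (adj M x v) (adj M u y) (adj M v y) (adj M x y) (loopless M u) (loopless M v) (MixedGraph.sym M u v) (minors u v x u v y)
    where
    simplify : ∀ uv p q r s t {uu vv vu} → uu ≡ none → vv ≡ none → vu ≡ flipE uv →
      alt ((entryN uu *ω entryN vv) *ω entryN t) ((entryN vu *ω entryN q) *ω entryN r) ((entryN p *ω entryN uv) *ω entryN s)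
          ((entryN uu *ω entryN q) *ω entryN s) ((entryN vu *ω entryN uv) *ω entryN t) ((entryN p *ω entryN vv) *ω entryN r) ≡ 0ω →
      edgeMinor uv p q r s t ≡ 0ω
    simplify _ _ _ _ _ _ ≡.refl ≡.refl ≡.refl eq = eq

  flip-none : ∀ {x y} → adj M x y ≡ none → adj M y x ≡ none
  flip-none {x} {y} eq = ≡.trans (MixedGraph.sym M x y) (≡.cong flipE eq)

  no-triangle : ∀ x → adj M x u ≡ none ⊎ adj M x v ≡ none
  no-triangle x = apply (adj M x u) (adj M x v) (MixedGraph.sym M x u) (MixedGraph.sym M x v) (loopless M x) (vanish x x)
    where
    apply : ∀ p q {r s t} → r ≡ flipE p → s ≡ flipE q → t ≡ none → edgeMinor (adj M u v) p q r s t ≡ 0ω → p ≡ none ⊎ q ≡ none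
    apply p q ≡.refl ≡.refl ≡.refl = triangle (adj M u v) p q u~v

  -- The minors leave such an x without neighbours, while a path from x to u either starts with an
  -- edge or shows x = u, which is adjacent to v.
  dominated : ∀ x → adj M x u ≡ none → adj M x v ≡ none → ⊥
  dominated x x≁u x≁v with connected x u
  ... | ε = u~v x≁v
  ... | _◅_ {j = y} x~y _ = x~y (apply (adj M u y) (adj M v y) (adj M x y) x≁u x≁v (vanish x y))
    where
    apply : ∀ r s t {p q} → p ≡ none → q ≡ none → edgeMinor (adj M u v) p q r s t ≡ 0ω → t ≡ none
    apply r s t ≡.refl ≡.refl = isolated (adj M u v) r s t u~v

  Side : Fin n → Set
  Side x = (adj M x v ≢ none × adj M x u ≡ none) ⊎ (adj M x u ≢ none × adj M x v ≡ none)

  side : ∀ x → Side x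
  side x with no-triangle x
  ... | inj₁ x≁u = inj₁ (dominated x x≁u , x≁u)
  ... | inj₂ x≁v = inj₂ ((λ x≁u → dominated x x≁u x≁v) , x≁v)

  -- `true` is the part containing u, whose vertices are the neighbours of v.
  colourOf : ∀ {x} → Side x → Bool
  colourOf (inj₁ _) = true
  colourOf (inj₂ _) = false

  phaseOf : ∀ {x} → Side x → T6
  phaseOf {x} (inj₁ _) = phaseᵛ (flipE (adj M x v))
  phaseOf {x} (inj₂ _) = phaseᵘ (adj M u v) (adj M u x)

  same-side : ∀ {x y} (a : Side x) (b : Side y) → colourOf a ≡ colourOf b → adj M x y ≡ none
  same-side {x} {y} (inj₁ (_ , x≁u)) (inj₁ (_ , y≁u)) _ = apply (adj M x v) (adj M v y) (adj M x y) x≁u (flip-none y≁u) (vanish x y)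
    where
    apply : ∀ q s t {p r} → p ≡ none → r ≡ none → edgeMinor (adj M u v) p q r s t ≡ 0ω → t ≡ none
    apply q s t ≡.refl ≡.refl = same-v (adj M u v) q s t u~v
  same-side {x} {y} (inj₂ (_ , x≁v)) (inj₂ (_ , y≁v)) _ = apply (adj M x u) (adj M u y) (adj M x y) x≁v (flip-none y≁v) (vanish x y)
    where
    apply : ∀ p r t {q s} → q ≡ none → s ≡ none → edgeMinor (adj M u v) p q r s t ≡ 0ω → t ≡ none
    apply p r t ≡.refl ≡.refl = same-u (adj M u v) p r t u~v

  cross-side : ∀ {x y} (a : Side x) (b : Side y) → colourOf a ≢ colourOf b → Phase (phaseOf a) (adj M x y) (phaseOf b)
  cross-side (inj₁ _) (inj₁ _) ≢ = ⊥-elim (≢ ≡.refl)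
  cross-side (inj₂ _) (inj₂ _) ≢ = ⊥-elim (≢ ≡.refl)
  cross-side {x} {y} (inj₁ (x~v , x≁u)) (inj₂ (y~u , y≁v)) _ = apply x≁u (flip-none y≁v) (vanish x y)
    where
    apply : ∀ {p s} → p ≡ none → s ≡ none → edgeMinor (adj M u v) p (adj M x v) (adj M u y) s (adj M x y) ≡ 0ω →
      Phase (phaseᵛ (flipE (adj M x v))) (adj M x y) (phaseᵘ (adj M u v) (adj M u y))
    apply ≡.refl ≡.refl = crossing (adj M u v) (adj M x v) (adj M u y) (adj M x y) u~v x~v (y~u ∘ flip-none)
  cross-side {x} {y} a@(inj₂ _) b@(inj₁ _) ≢ =
    ≡.subst (λ e → Phase (phaseOf a) e (phaseOf b)) (≡.sym (MixedGraph.sym M y x)) (phase-flip _ _ _ (cross-side b a (≢ ∘ ≡.sym)))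

  bipartition : Bipartition M
  bipartition = record
    { colour = λ x → colourOf (side x)
    ; phase  = λ x → phaseOf (side x)
    ; same   = λ x y → same-side (side x) (side y)
    ; cross  = λ x y → cross-side (side x) (side y)
    }

-- Sizes of the two parts, and matching them.

bit : Bool → ℕ
bit true  = 1
bit false = 0

count : ∀ {n} → (Fin n → Bool) → ℕ
count c = sumℕ (λ i → bit (c i))

count-complement : ∀ {n} (c : Fin n → Bool) → count c ℕ.+ count (not ∘ c) ≡ n
count-complement {zero}  c = ≡.refl
count-complement {suc n} c with c zero
... | true  = ≡.cong suc (count-complement (c ∘ suc))
... | false = ≡.trans (ℕₚ.+-suc _ _) (≡.cong suc (count-complement (c ∘ suc)))

count-positive : ∀ {n} (c : Fin n → Bool) {k} → count c ≡ suc k → ∃ λ j → c j ≡ true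
count-positive {suc n} c eq with c zero in c₀
... | true  = zero , c₀
... | false with count-positive (c ∘ suc) eq
...   | j , cⱼ = suc j , cⱼ

not-injective : ∀ {a b} → not a ≡ not b → a ≡ b
not-injective {true}  {true}  _ = ≡.refl
not-injective {false} {false} _ = ≡.refl

colour-occurs : ∀ {n} (c c′ : Fin (suc n) → Bool) → count c ≡ count c′ → count (not ∘ c) ≡ count (not ∘ c′) →
  ∃ λ j → c′ j ≡ c zero
colour-occurs c c′ eq eq⁻ with c zero
... | true  = count-positive c′ (≡.sym eq)
... | false with count-positive (not ∘ c′) (≡.sym eq⁻)
...   | j , h = j , not-injective h

count-remove : ∀ {n} (c c′ : Fin (suc n) → Bool) j → c′ j ≡ c zero → count c ≡ count c′ →
  count (c ∘ suc) ≡ count (c′ ∘ punchIn j)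
count-remove c c′ j c′ⱼ eq = ℕₚ.+-cancelˡ-≡ (bit (c zero)) _ _
  (≡.trans eq (≡.trans (sumℕ-remove {i = j} (λ i → bit (c′ i))) (≡.cong (λ b → bit b ℕ.+ count (c′ ∘ punchIn j)) c′ⱼ)))

-- Vertex 0 is sent to some vertex of its own colour and both are removed. Equality of both counts
-- guarantees such a vertex whichever colour 0 has.
colour-permutation : ∀ {n} (c c′ : Fin n → Bool) → count c ≡ count c′ → count (not ∘ c) ≡ count (not ∘ c′) →
  Σ (Permutation n n) λ σ → ∀ x → c′ (σ ⟨$⟩ʳ x) ≡ c x
colour-permutation {zero}  c c′ eq eq⁻ = Perm.id , λ ()
colour-permutation {suc n} c c′ eq eq⁻ with colour-occurs c c′ eq eq⁻
... | j , c′ⱼ with colour-permutation (c ∘ suc) (c′ ∘ punchIn j)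
                     (count-remove c c′ j c′ⱼ eq) (count-remove (not ∘ c) (not ∘ c′) j (≡.cong not c′ⱼ) eq⁻)
...   | π , πc = Perm.insert zero j π , λ { zero → c′ⱼ ; (suc x) → πc x }

ι : ℕ → ℤω
ι k = ⟨ + k , + 0 ⟩

∑-ι : ∀ {n} (f : Fin n → ℕ) → ∑ (λ i → ι (f i)) ≡ ι (sumℕ f)
∑-ι {zero}  f = ∑-empty _
∑-ι {suc n} f = ≡.trans (∑-suc _) (≡.cong (ι (f zero) +ω_) (∑-ι (f ∘ suc)))

module _ {n} {M : MixedGraph n} (B : Bipartition M) where

  open Bipartition B

  χ χ̄ : Fin n → ℤω
  χ x = ι (bit (colour x))
  χ̄ x = ι (bit (not (colour x)))

  entry-norm : ∀ e → e ≢ none → entryN e *ω entryN (flipE e) ≡ 1ω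
  entry-norm none e≢none = ⊥-elim (e≢none ≡.refl)
  entry-norm und  _ = ≡.refl
  entry-norm arc  _ = ≡.refl
  entry-norm rev  _ = ≡.refl

  zero-norm : ∀ {e f} → e ≡ none → f ≡ none → entryN e *ω entryN f ≡ 0ω
  zero-norm ≡.refl ≡.refl = ≡.refl

  -- The left side is |N_xy|², so the trace of A² counts ordered pairs of adjacent vertices; as a
  -- sum of products of indicators it factors into part sizes.
  square-entry : ∀ x y → N M x y *ω N M y x ≡ (χ x *ω χ̄ y) +ω (χ̄ x *ω χ y)
  square-entry x y with colour x in cx | colour y in cy
  ... | true  | true  = zero-norm (same x y (≡.trans cx (≡.sym cy))) (same y x (≡.trans cy (≡.sym cx)))
  ... | false | false = zero-norm (same x y (≡.trans cx (≡.sym cy))) (same y x (≡.trans cy (≡.sym cx)))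
  ... | true  | false rewrite MixedGraph.sym M x y = entry-norm _ (proj₁ (cross x y (λ eq → case (≡.trans (≡.sym cx) (≡.trans eq cy)))))
    where
    case : true ≡ false → ⊥
    case ()
  ... | false | true  rewrite MixedGraph.sym M x y = entry-norm _ (proj₁ (cross x y (λ eq → case (≡.trans (≡.sym cx) (≡.trans eq cy)))))
    where
    case : false ≡ true → ⊥
    case ()

  blacks whites : ℕ
  blacks = count colour
  whites = count (not ∘ colour)

  t₁-count : t₁ (N M) ≡ (ι blacks *ω ι whites) +ω (ι whites *ω ι blacks)
  t₁-count = begin
    t₁ (N M)                                                          ≡⟨ ∑-cong (λ x → ∑-cong (square-entry x)) ⟩
    ∑ (λ x → ∑ (λ y → (χ x *ω χ̄ y) +ω (χ̄ x *ω χ y)))                  ≡⟨ ∑-cong (λ x → ∑-+ (λ y → χ x *ω χ̄ y) (λ y → χ̄ x *ω χ y)) ⟩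
    ∑ (λ x → ∑ (λ y → χ x *ω χ̄ y) +ω ∑ (λ y → χ̄ x *ω χ y))            ≡⟨ ∑-+ (λ x → ∑ (λ y → χ x *ω χ̄ y)) (λ x → ∑ (λ y → χ̄ x *ω χ y)) ⟩
    ∑ (λ x → ∑ (λ y → χ x *ω χ̄ y)) +ω ∑ (λ x → ∑ (λ y → χ̄ x *ω χ y))  ≡⟨ ≡.cong₂ _+ω_ (product χ χ̄) (product χ̄ χ) ⟩
    (∑ χ *ω ∑ χ̄) +ω (∑ χ̄ *ω ∑ χ)                                      ≡⟨ ≡.cong₂ (λ s t → (s *ω t) +ω (t *ω s)) (∑-ι (bit ∘ colour)) (∑-ι (bit ∘ not ∘ colour)) ⟩
    (ι blacks *ω ι whites) +ω (ι whites *ω ι blacks)                  ∎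
    where
    open ≡.≡-Reasoning
    product : (f g : Fin n → ℤω) → ∑ (λ x → ∑ (λ y → f x *ω g y)) ≡ ∑ f *ω ∑ g
    product f g = ≡.sym (≡.trans (∑-* (∑ g) f) (∑-cong (λ x → *-∑ (f x) g)))

  complement : Bipartition M
  complement = record
    { colour = not ∘ colour
    ; phase  = phase
    ; same   = λ x y eq → same x y (not-injective eq)
    ; cross  = λ x y ≢ → cross x y (≢ ∘ ≡.cong not)
    }

-- Equal sums and products make `a` a root of (X - c)(X - d), and ℤ has no zero divisors.
product-determines : ∀ a b c d → a ℕ.+ b ≡ c ℕ.+ d →
  (ι a *ω ι b) +ω (ι b *ω ι a) ≡ (ι c *ω ι d) +ω (ι d *ω ι c) → a ≡ c ⊎ a ≡ d
product-determines a b c d sums products =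
  Sum.map (ℤₚ.+-injective ∘ ℤₚ.i-j≡0⇒i≡j (+ a) (+ c)) (ℤₚ.+-injective ∘ ℤₚ.i-j≡0⇒i≡j (+ a) (+ d))
    (ℤₚ.i*j≡0⇒i≡0∨j≡0 (+ a ℤ.- + c) factors)
  where
  twice : ∀ x y → (x ℤ.* y ℤ.- + 0 ℤ.* + 0) ℤ.+ (y ℤ.* x ℤ.- + 0 ℤ.* + 0) ≡ + 2 ℤ.* (x ℤ.* y)
  twice = solve-∀
  ab≡cd : + a ℤ.* + b ≡ + c ℤ.* + d
  ab≡cd = ℤₚ.*-cancelˡ-≡ (+ 2) _ _ (≡.trans (≡.sym (twice (+ a) (+ b))) (≡.trans (≡.cong re products) (twice (+ c) (+ d))))
  vieta : ∀ x y z w → (x ℤ.- z) ℤ.* (x ℤ.- w) ≡ (x ℤ.* ((x ℤ.+ y) ℤ.- (z ℤ.+ w))) ℤ.+ (z ℤ.* w ℤ.- x ℤ.* y)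
  vieta = solve-∀
  factors : (+ a ℤ.- + c) ℤ.* (+ a ℤ.- + d) ≡ + 0
  factors = ≡.trans (vieta (+ a) (+ b) (+ c) (+ d)) (≡.cong₂ ℤ._+_
    (≡.trans (≡.cong (+ a ℤ.*_) (ℤₚ.i≡j⇒i-j≡0 (≡.cong +_ sums))) (ℤₚ.*-zeroʳ (+ a)))
    (ℤₚ.i≡j⇒i-j≡0 (≡.sym ab≡cd)))

-- Switching one complete bipartite graph into another.

pullback : ∀ {n} → MixedGraph n → Permutation n n → MixedGraph n
pullback M σ = record
  { adj = λ x y → adj M (σ ⟨$⟩ʳ x) (σ ⟨$⟩ʳ y)
  ; loopless = λ x → loopless M (σ ⟨$⟩ʳ x)
  ; sym = λ x y → MixedGraph.sym M (σ ⟨$⟩ʳ x) (σ ⟨$⟩ʳ y)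
  }

module _ {n} {M M′ : MixedGraph n} (B : Bipartition M) (B′ : Bipartition M′)
  (blacks≡ : blacks B ≡ blacks B′) where

  private
    module B = Bipartition B
    module B′ = Bipartition B′

  whites≡ : whites B ≡ whites B′
  whites≡ = ℕₚ.+-cancelˡ-≡ (blacks B) _ _ (≡.trans (count-complement B.colour)
    (≡.sym (≡.trans (≡.cong (ℕ._+ whites B′) blacks≡) (count-complement B′.colour))))

  equal-parts⇒equivalent : Star Step (n , M) (n , M′)
  equal-parts⇒equivalent with colour-permutation B.colour B′.colour blacks≡ whites≡
  -- The switching reaches the copy of M′ transported to the vertices of M, on which σ is an
  -- isomorphism by construction.
  ... | σ , σ-colour = switch {M' = pullback M′ σ} (p , (undirected , directed) , switched) ◅ iso (σ , λ x y → ≡.refl) ◅ ε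
    where
    p : Fin n → T6
    -- Conjugation by the diagonal matrix of ω^(p x) turns ω^(φ y - φ x) into ω^(φ′ y - φ′ x).
    p x = B′.phase (σ ⟨$⟩ʳ x) ⊖6 B.phase x
    edge : ∀ x y → B.colour x ≢ B.colour y → Switches (p x) (p y) (adj M x y) (adj M′ (σ ⟨$⟩ʳ x) (σ ⟨$⟩ʳ y))
    edge x y ≢ = switches _ _ (B.phase x) (B.phase y) (B′.phase (σ ⟨$⟩ʳ x)) (B′.phase (σ ⟨$⟩ʳ y)) (B.cross x y ≢)
      (B′.cross (σ ⟨$⟩ʳ x) (σ ⟨$⟩ʳ y) (λ eq → ≢ (≡.trans (≡.sym (σ-colour x)) (≡.trans eq (σ-colour y)))))
    coloured : ∀ {x y e} → adj M x y ≡ e → e ≢ none → B.colour x ≢ B.colour y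
    coloured {x} {y} ≡.refl e≢none eq = e≢none (B.same x y eq)
    undirected : ∀ x y → adj M x y ≡ und → (p y ≡ p x) ⊎ (p y ≡ p x ⊕6 1) ⊎ (p x ≡ p y ⊕6 1)
    undirected x y eq = proj₁ (proj₂ (edge x y (coloured eq λ ()))) eq
    directed : ∀ x y → adj M x y ≡ arc → (p y ≡ p x) ⊎ (p y ≡ p x ⊕6 5) ⊎ (p y ≡ p x ⊕6 4)
    directed x y eq = proj₂ (proj₂ (edge x y (coloured eq λ ()))) eq
    switched : ∀ x y → adj M′ (σ ⟨$⟩ʳ x) (σ ⟨$⟩ʳ y) ≡ switchEntry (p x) (p y) (adj M x y)
    switched x y with B.colour x ≟ᵇ B.colour y
    ... | no ≢   = proj₁ (edge x y ≢)
    ... | yes eq rewrite B.same x y eq = B′.same _ _ (≡.trans (σ-colour x) (≡.trans eq (≡.sym (σ-colour y))))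

equal-traces⇒equivalent : ∀ {n} {M M′ : MixedGraph n} → Bipartition M → Bipartition M′ → t₁ (N M) ≡ t₁ (N M′) →
  Star Step (n , M) (n , M′)
-- In the second case the blacks of M match the whites of M′, which are the blacks of
-- `complement B′`.
equal-traces⇒equivalent B B′ traces = [ equal-parts⇒equivalent B B′ , equal-parts⇒equivalent B (complement B′) ]′
  (product-determines (blacks B) (whites B) (blacks B′) (whites B′)
    (≡.trans (count-complement (Bipartition.colour B)) (≡.sym (count-complement (Bipartition.colour B′))))
    (≡.trans (≡.sym (t₁-count B)) (≡.trans traces (t₁-count B′))))

-- Assembling the theorem.

distinct⇒edge : ∀ {n} {M : MixedGraph n} → Connected M → ∀ {u v} → u ≢ v → ∃ λ w → adj M u w ≢ none
distinct⇒edge connected {u} {v} u≢v with connected u v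
... | ε                   = ⊥-elim (u≢v ≡.refl)
... | _◅_ {j = w} u~w _   = w , u~w

-- Equal rows would annihilate the nonzero 2 × 2 minor. With connectedness, two distinct vertices
-- yield the edge on which `Structure` is built.
rank-two⇒distinct : ∀ {n} {M : MixedGraph n} → rankIs M 2 → Σ (Fin n) λ u → Σ (Fin n) λ v → u ≢ v
rank-two⇒distinct {M = M} ((f , g , nonzero) , _) = f zero , f (suc zero) , λ eq → nonzero
  (det-equalRows (λ a b → N M (f a) (g b)) zero (suc zero) (λ ()) (λ c → ≡.cong (λ x → N M x (g c)) eq))

triple : ∀ {n} → Fin n → Fin n → Fin n → Fin 3 → Fin n
triple x y z zero             = x
triple x y z (suc zero)       = y
triple x y z (suc (suc zero)) = z

rank-two⇒minors : ∀ {n} {M : MixedGraph n} → rankIs M 2 → ∀ x y z i j k → minor³ (N M) x y z i j k ≡ 0ω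
rank-two⇒minors {M = M} (_ , minors) x y z i j k =
  ≡.trans (≡.sym (det₃ (N M) (triple x y z) (triple i j k))) (minors (triple x y z) (triple i j k))

same-size : ∀ {n} (M M′ : MixedGraph n) → Connected M → Connected M′ → rankIs M 2 →
  (∀ k → trace (pow (N M) k) ≡ trace (pow (N M′) k)) → Star Step (n , M) (n , M′)
same-size M M′ connected connected′ rank traces = equal-traces⇒equivalent
  (Structure.bipartition M connected minors u (proj₁ edge) (proj₂ edge))
  (Structure.bipartition M′ connected′ (minors-zero-transfer positive (N-hermitian M′) traces minors) u (proj₁ edge′) (proj₂ edge′))
  (≡.trans (≡.sym (trace-pow-2 (N M))) (≡.trans (traces 2) (trace-pow-2 (N M′))))
  where
  minors = rank-two⇒minors {M = M} rank
  u = proj₁ (rank-two⇒distinct {M = M} rank)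
  u≢v = proj₂ (proj₂ (rank-two⇒distinct {M = M} rank))
  edge = distinct⇒edge {M = M} connected u≢v
  -- Both graphs live on `Fin n`, so the same two distinct vertices provide an edge of M′ through
  -- its connectedness.
  edge′ = distinct⇒edge {M = M′} connected′ u≢v

theorem5p10 : ∀ {n} (M : MixedGraph n) → Connected M → rankIs M 2 →
    ∀ {m} (M' : MixedGraph m) → Connected M' → Cospectral M M' →
    SwitchingEquivalent M M'
theorem5p10 {n} M connected rank {m} M′ connected′ cospectral =
  conclude (cospectral⇒size {M = M} {M′} cospectral) M′ connected′ cospectral
  where
  conclude : n ≡ m → (M′ : MixedGraph m) → Connected M′ → Cospectral M M′ → SwitchingEquivalent M M′
  conclude ≡.refl M′ connected′ cospectral =
    inj₁ (same-size M M′ connected connected′ rank (cospectral⇒traces {M = M} {M′} cospectral))
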